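{- Let $d\in\mathbb N$ and let $(G_n)$ be a sequence of finite graphs with maximum degree at most $d$ and $\lim_{n\to\infty}|G_n|=\infty$. Then the following are equivalent: (1) $(G_n)$ is BS-convergent; (2) $(G_n)$ is $\mathrm{FO}^{\mathrm{local}}_1$-convergent; (3) $(G_n)$ is $\mathrm{FO}^{\mathrm{local}}$-convergent.
   Context: For a first-order graph formula $\phi$ with free variables among $x_1,\dots,x_p$ and a finite graph $G$, $\langle\phi,G\rangle=|\{(v_1,\dots,v_p)\in V(G)^p:G\models\phi(v_1,\dots,v_p)\}|/|G|^p$; for a set $X$ of formulas, $(G_n)$ is $X$-convergent if $\langle\phi,G_n\rangle$ converges for all $\phi\in X$. A formula $\phi$ with free variables among $x_1,\dots,x_p$ is $r$-local if for every graph $G$ and $v_1,\dots,v_p\in V(G)$, $G\models\phi(v_1,\dots,v_p)$ iff $G[N_r(v_1,\dots,v_p)]\models\phi(v_1,\dots,v_p)$, where $G[N_r(v_1,\dots,v_p)]$ is the subgraph induced by the vertices at distance at most $r$ from some $v_i$; $\phi$ is local if it is $r$-local for some $r$. $\mathrm{FO}^{\mathrm{local}}$ is the set of local formulas and $\mathrm{FO}^{\mathrm{local}}_p$ the set of local formulas with free variables among $x_1,\dots,x_p$. $(G_n)$ is BS-convergent if for every integer $r$ and every finite rooted connected graph $(F,o)$ with maximum degree at most $d$ the limit $\lim_{n\to\infty}|\{v: (B_{G_n}(v,r),v)\cong(F,o)\}|/|G_n|$ exists, where $B_G(v,r)$ is the subgraph induced by vertices at distance at most $r$ from $v$ and $\cong$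 is isomorphism of rooted graphs. -}

module Defs where

open import Data.Bool.Base using (Bool; true; false; T)
open import Data.Bool.Properties using (T?)
import Data.Bool.Properties as Bool
open import Data.Empty using (⊥)
open import Data.Fin.Base using (Fin)
import Data.Fin.Properties as Fin
open import Data.Integer.Base using (+_)
open import Data.Irrelevant using ([_])
open import Data.List.Base as List using (List; length; filter; allFin; cartesianProductWith)
open import Data.List.Membership.Propositional using (_∈_; lose)
open import Data.List.Membership.Propositional.Properties
  using (∈-allFin; ∈-cartesianProductWith⁺)
open import Data.List.Relation.Unary.Any as Any using (here)
open import Data.Nat.Base using (ℕ; zero; suc; _≤_; z≤n; s≤s; s≤s⁻¹; _^_)
open import Data.Nat.Properties using (anyUpTo?)
open import Data.Product.Base using (∃; _×_; _,_; proj₁; proj₂)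
open import Data.Rational.Base as ℚ using (ℚ; 0ℚ; _/_)
open import Data.Refinement.Base using (Refinement; _,_; value)
open import Data.Vec.Base as Vec using (Vec; []; _∷_; lookup; tabulate)
open import Data.Vec.Properties using (lookup∘tabulate)
open import Function.Base using (_∘_)
open import Function.Bundles using (Inverse; _↔_; _⇔_; mk↔ₛ′; mk⇔; Equivalence)
open import Level using (0ℓ)
open import Relation.Binary.PropositionalEquality
  using (_≡_; refl; sym; trans; cong; cong₂; subst)
open import Relation.Nullary.Decidable
  using (Dec; yes; no; _×-dec_; _→-dec_; ¬?; map′; recompute)
open import Relation.Nullary.Negation using (¬_)
open import Relation.Unary using (Pred; Decidable)

------------------------------------------------------------------------
-- Real numbers and convergence

-- Reals are Bishop's: regular sequences of rationals.
record ℝ : Set where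
  field
    approx  : ℕ → ℚ
    regular : ∀ m n →
      ℚ.∣ approx m ℚ.- approx n ∣ ℚ.≤ (+ 1 / suc m) ℚ.+ (+ 1 / suc n)

open ℝ public

-- |q - x| ≤ ε, using |x - approx x k| ≤ 1/(k+1).
Within : ℚ → ℚ → ℝ → Set
Within ε q x = ∀ k → ℚ.∣ q ℚ.- approx x k ∣ ℚ.≤ ε ℚ.+ (+ 1 / suc k)

_⟶_ : (ℕ → ℚ) → ℝ → Set
a ⟶ x = ∀ ε → 0ℚ ℚ.< ε → ∃ λ N → ∀ n → N ≤ n → Within ε (a n) x

Converges : (ℕ → ℚ) → Set
Converges a = ∃ λ x → a ⟶ x

-- k / n as a rational.  The value 0 at n = 0 is a junk value.
ratio : ℕ → ℕ → ℚ
ratio k zero    = 0ℚ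
ratio k (suc n) = + k / suc n

------------------------------------------------------------------------
-- Graphs

-- Simple graphs, finite or infinite.
record Graph : Set₁ where
  infix 4 _~_
  field
    V        : Set
    _~_      : V → V → Set
    ~-sym    : ∀ {u v} → u ~ v → v ~ u
    ~-irrefl : ∀ {v} → ¬ (v ~ v)

open Graph public using (V)

-- Finite graphs, with vertex set {0, …, order - 1}.
record FinGraph : Set where
  field
    order      : ℕ
    adj        : Fin order → Fin order → Bool
    adj-sym    : ∀ u v → adj u v ≡ adj v u
    adj-irrefl : ∀ v → adj v v ≡ false

  graph : Graph
  graph = record
    { V        = Fin order
    ; _~_      = λ u v → T (adj u v)
    ; ~-sym    = λ {u} {v} → subst T (adj-sym u v)
    ; ~-irrefl = λ {v} → subst T (adj-irrefl v)
    }

  degree : Fin order → ℕ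
  degree v = length (filter (λ u → T? (adj v u)) (allFin order))

open FinGraph public using (order; adj; graph; degree)

MaxDegree≤ : ℕ → FinGraph → Set
MaxDegree≤ d G = ∀ v → degree G v ≤ d

-- Walk G k u v: there is a walk with k edges from u to v.
Walk : (G : Graph) → ℕ → V G → V G → Set
Walk G zero    u v = u ≡ v
Walk G (suc k) u v = ∃ λ w → Graph._~_ G u w × Walk G k w v

-- The distance from u to v (infinite in different components) is at most r.
Dist≤ : (G : Graph) → ℕ → V G → V G → Set
Dist≤ G r u v = ∃ λ k → k ≤ r × Walk G k u v

Connected : Graph → Set
Connected G = ∀ u v → ∃ λ k → Walk G k u v

-- Membership proofs in a Refinement are irrelevant, so that vertices of the
-- induced subgraph are equal exactly when they are equal in G.
induced : (G : Graph) → Pred (V G) 0ℓ → Graph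
induced G W = record
  { V        = Refinement (V G) W
  ; _~_      = λ u v → value u ~ value v
  ; ~-sym    = ~-sym
  ; ~-irrefl = ~-irrefl
  }
  where open Graph G using (_~_; ~-sym; ~-irrefl)

record RootedIso (G : Graph) (a : V G) (H : Graph) (b : V H) : Set where
  field
    vertices : V G ↔ V H
  open Inverse vertices public using (to; from)
  field
    adjacency : ∀ u v → Graph._~_ G u v ⇔ Graph._~_ H (to u) (to v)
    root      : to a ≡ b

ball : (G : Graph) → ℕ → V G → Graph
ball G r v = induced G (Dist≤ G r v)

centre : (G : Graph) (r : ℕ) (v : V G) → V (ball G r v)
centre G r v = v , [ (0 , z≤n , refl) ]

-- N r vs is the set of vertices at distance at most r from some entry of vs.
N : (G : Graph) → ℕ → ∀ {p} → Vec (V G) p → Pred (V G) 0ℓ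
N G r vs u = ∃ λ i → Dist≤ G r (lookup vs i) u

-- The tuple vs itself, as a tuple of vertices of G[N r vs].
centres : (G : Graph) (r : ℕ) → ∀ {p} (vs : Vec (V G) p) →
          Vec (V (induced G (N G r vs))) p
centres G r vs = tabulate λ i → lookup vs i , [ (i , 0 , z≤n , refl) ]

------------------------------------------------------------------------
-- First-order logic of graphs

infix  6 _≐_ _∼_
infixr 5 _⊃_

-- Formula p: formulas with free variables among p variables (de Bruijn:
-- `all` binds variable zero).  The connectives ⊥, ⊃, ∀ form a complete set
-- for classical logic; ¬φ is φ ⊃ ⊥ and ∃φ is ¬∀¬φ.
data Formula (p : ℕ) : Set where
  _≐_ _∼_ : Fin p → Fin p → Formula p
  false   : Formula p
  _⊃_     : Formula p → Formula p → Formula p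
  all     : Formula (suc p) → Formula p

-- Classical truth.  The double negations on atoms make every instance of
-- satisfaction ¬¬-stable, so that classical logic is sound in all graphs,
-- including infinite ones whose edge relation need not be decidable.
infix 3 _⊨_[_]
_⊨_[_] : (G : Graph) → ∀ {p} → Formula p → Vec (V G) p → Set
G ⊨ i ≐ j [ ρ ] = ¬ ¬ (lookup ρ i ≡ lookup ρ j)
G ⊨ i ∼ j [ ρ ] = ¬ ¬ (Graph._~_ G (lookup ρ i) (lookup ρ j))
G ⊨ false [ ρ ] = ⊥
G ⊨ φ ⊃ ψ [ ρ ] = G ⊨ φ [ ρ ] → G ⊨ ψ [ ρ ]
G ⊨ all φ [ ρ ] = (v : V G) → G ⊨ φ [ v ∷ ρ ]

IsLocal : ℕ → ∀ {p} → Formula p → Set₁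
IsLocal r {p} φ = (G : Graph) (vs : Vec (V G) p) →
  (G ⊨ φ [ vs ]) ⇔ (induced G (N G r vs) ⊨ φ [ centres G r vs ])

Local : ∀ {p} → Formula p → Set₁
Local φ = ∃ λ r → IsLocal r φ

FormulaSet : Set₂
FormulaSet = ∀ p → Formula p → Set₁

FO-local : FormulaSet
FO-local p φ = Local φ

FO-local₁ : FormulaSet
FO-local₁ p φ = p ≡ 1 × Local φ

sat? : (G : FinGraph) → ∀ {p} (φ : Formula p) → Decidable (graph G ⊨ φ [_])
sat? G (i ≐ j) ρ = ¬? (¬? (lookup ρ i Fin.≟ lookup ρ j))
sat? G (i ∼ j) ρ = ¬? (¬? (T? (adj G (lookup ρ i) (lookup ρ j))))
sat? G false   ρ = no λ ()
sat? G (φ ⊃ ψ) ρ = sat? G φ ρ →-dec sat? G ψ ρ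
sat? G (all φ) ρ = Fin.all? λ v → sat? G φ (v ∷ ρ)

tuples : ∀ n p → List (Vec (Fin n) p)
tuples n zero    = List.[ [] ]
tuples n (suc p) = cartesianProductWith _∷_ (allFin n) (tuples n p)

⟨_,_⟩ : ∀ {p} → Formula p → FinGraph → ℚ
⟨_,_⟩ {p} φ G =
  ratio (length (filter (sat? G φ) (tuples (order G) p))) (order G ^ p)

Convergent : FormulaSet → (ℕ → FinGraph) → Set₁
Convergent X G = ∀ {p} (φ : Formula p) → X p φ → Converges (λ n → ⟨ φ , G n ⟩)

------------------------------------------------------------------------
-- Benjamini–Schramm convergence

∈-tuples : ∀ {n p} (xs : Vec (Fin n) p) → xs ∈ tuples n p
∈-tuples []       = here refl
∈-tuples (x ∷ xs) = ∈-cartesianProductWith⁺ _∷_ (∈-allFin x) (∈-tuples xs)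

walk? : (G : FinGraph) → ∀ k u v → Dec (Walk (graph G) k u v)
walk? G zero    u v = u Fin.≟ v
walk? G (suc k) u v = Fin.any? λ w → T? (adj G u w) ×-dec walk? G k w v

dist≤? : (G : FinGraph) → ∀ r u v → Dec (Dist≤ (graph G) r u v)
dist≤? G r u v =
  map′ (λ (k , k<1+r , w) → k , s≤s⁻¹ k<1+r , w)
       (λ (k , k≤r   , w) → k , s≤s k≤r     , w)
       (anyUpTo? (λ k → walk? G k u v) (suc r))

-- Rooted isomorphism of a ball with a finite graph is decided by searching
-- for the tuple listing the images of the vertices of F in G.
module BallIso (G : FinGraph) (r : ℕ) (v : Fin (order G))
               (F : FinGraph) (o : Fin (order F)) where

  private
    D : Fin (order G) → Set
    D = Dist≤ (graph G) r v

    D? : Decidable D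
    D? = dist≤? G r v

  Iso : Set
  Iso = RootedIso (ball (graph G) r v) (centre (graph G) r v) (graph F) o

  Listing : Vec (Fin (order G)) (order F) → Set
  Listing e =
      (∀ i → D (lookup e i))
    × (∀ w → D w → ∃ λ i → lookup e i ≡ w)
    × (∀ i j → lookup e i ≡ lookup e j → i ≡ j)
    × (∀ i j → adj G (lookup e i) (lookup e j) ≡ adj F i j)
    × lookup e o ≡ v

  listing? : Decidable Listing
  listing? e =
      Fin.all? (λ i → D? (lookup e i))
    ×-dec Fin.all? (λ w → D? w →-dec Fin.any? λ i → lookup e i Fin.≟ w)
    ×-dec Fin.all? (λ i → Fin.all? λ j →
            (lookup e i Fin.≟ lookup e j) →-dec (i Fin.≟ j))
    ×-dec Fin.all? (λ i → Fin.all? λ j →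
            adj G (lookup e i) (lookup e j) Bool.≟ adj F i j)
    ×-dec (lookup e o Fin.≟ v)

  private
    refinement-≡ : {x y : Refinement (Fin (order G)) D} →
                   value x ≡ value y → x ≡ y
    refinement-≡ refl = refl

    T-ext : ∀ {a b} → T a ⇔ T b → a ≡ b
    T-ext {false} {false} _ = refl
    T-ext {true}  {true}  _ = refl
    T-ext {false} {true}  e with () ← Equivalence.from e _
    T-ext {true}  {false} e with () ← Equivalence.to e _

  listing⇒iso : ∃ Listing → Iso
  listing⇒iso (e , inD , onto , inj , edges , rt) = record
    { vertices  = mk↔ₛ′ to from
        (λ i → inj _ _ (to-eq (from i)))
        (λ x → refinement-≡ (to-eq x))
    ; adjacency = λ x y →
        let eq : adj G (value x) (value y) ≡ adj F (to x) (to y)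
            eq = trans (sym (cong₂ (adj G) (to-eq x) (to-eq y))) (edges _ _)
        in mk⇔ (subst T eq) (subst T (sym eq))
    ; root      = inj _ _ (trans (to-eq (centre (graph G) r v)) (sym rt))
    }
    where
    index : (x : Refinement (Fin (order G)) D) → ∃ λ i → lookup e i ≡ value x
    index (w , [ p ]) = onto w (recompute (D? w) p)

    to : Refinement (Fin (order G)) D → Fin (order F)
    to x = proj₁ (index x)

    to-eq : ∀ x → lookup e (to x) ≡ value x
    to-eq x = proj₂ (index x)

    from : Fin (order F) → Refinement (Fin (order G)) D
    from i = lookup e i , [ inD i ]

  iso⇒listing : Iso → ∃ Listing
  iso⇒listing I = e , inD , onto , inj , edges , rt
    where
    open RootedIso I
    open Inverse vertices using (strictlyInverseˡ; strictlyInverseʳ)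

    e : Vec (Fin (order G)) (order F)
    e = tabulate (value ∘ from)

    e≡ : ∀ i → lookup e i ≡ value (from i)
    e≡ = lookup∘tabulate (value ∘ from)

    member : (x : Refinement (Fin (order G)) D) → D (value x)
    member (w , [ p ]) = recompute (D? w) p

    inD : ∀ i → D (lookup e i)
    inD i = subst D (sym (e≡ i)) (member (from i))

    onto : ∀ w → D w → ∃ λ i → lookup e i ≡ w
    onto w p = to x , trans (e≡ (to x)) (cong value (strictlyInverseʳ x))
      where
      x : Refinement (Fin (order G)) D
      x = w , [ p ]

    inj : ∀ i j → lookup e i ≡ lookup e j → i ≡ j
    inj i j eq =
      trans (sym (strictlyInverseˡ i))
        (trans (cong to (refinement-≡ (trans (sym (e≡ i)) (trans eq (e≡ j)))))
          (strictlyInverseˡ j))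

    edges : ∀ i j → adj G (lookup e i) (lookup e j) ≡ adj F i j
    edges i j =
      trans (cong₂ (adj G) (e≡ i) (e≡ j))
        (trans (T-ext (adjacency (from i) (from j)))
          (cong₂ (adj F) (strictlyInverseˡ i) (strictlyInverseˡ j)))

    rt : lookup e o ≡ v
    rt = trans (e≡ o)
      (cong value (trans (cong from (sym root))
                         (strictlyInverseʳ (centre (graph G) r v))))

  iso? : Dec Iso
  iso? = map′ (λ any → listing⇒iso (Any.satisfied any))
              (λ I → let (e , l) = iso⇒listing I in lose (∈-tuples e) l)
              (Any.any? listing? (tuples (order G) (order F)))

ballFrequency : ℕ → (F : FinGraph) → Fin (order F) → FinGraph → ℚ
ballFrequency r F o G =
  ratio (length (filter (λ v → BallIso.iso? G r v F o) (allFin (order G))))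
        (order G)

BSConvergent : ℕ → (ℕ → FinGraph) → Set
BSConvergent d G =
  ∀ r (F : FinGraph) (o : Fin (order F)) →
  Connected (graph F) → MaxDegree≤ d F →
  Converges (λ n → ballFrequency r F o (G n))

OrderTendsToInfinity : (ℕ → FinGraph) → Set
OrderTendsToInfinity G = ∀ M → ∃ λ N → ∀ n → N ≤ n → M ≤ order (G n)

{-# OPTIONS --safe #-}

-- Only (1) ⇒ (3) and (2) ⇒ (1) need an argument; all convergence is reduced to
-- the Cauchy property of rational sequences.
--
-- (2) ⇒ (1): "(F , o) is the whole graph rooted at x" is a first-order formula
-- in x.  Restricting its quantifiers to the vertices at distance at most r from
-- x makes it r-local, and it then defines the vertices whose r-ball is (F , o).
--
-- (1) ⇒ (3): let φ be r-local.  Balls of radius r have bounded size, so they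
-- fall into finitely many isomorphism types, whose frequencies converge.  If
-- the entries of a tuple are pairwise at distance more than 2r + 1, the graph
-- induced on its r-neighbourhood is the disjoint union of the balls, so the
-- truth of φ is determined by the types of the entries.  All but a fraction
-- O(1 / |G|) of the tuples are of this kind; hence ⟨ φ , G ⟩ is asymptotically
-- a fixed polynomial in the frequencies of the types.

module Submission where

open import Defs
open import Data.Bool.Base using (Bool; true; false; T; _∧_; _∨_; not; if_then_else_)
open import Data.Bool.Properties using (T?)
import Data.Bool.Properties as Bool
open import Data.Empty using (⊥-elim; ⊥-elim-irr)
open import Data.Fin.Base as Fin using (Fin; zero; suc; _↑ˡ_; _↑ʳ_; combine; remQuot)
import Data.Fin.Properties as Fin
open import Data.Integer.Base as ℤ using (+[1+_]; -[1+_])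
import Data.Integer.Properties as ℤ
open import Data.Irrelevant using ([_])
open import Data.List.Base as List
  using (List; []; _∷_; length; filter; allFin; cartesianProductWith; concatMap; upTo)
import Data.List.Properties as List
open import Data.List.Membership.Propositional using (_∈_; lose)
open import Data.List.Membership.Propositional.Properties
  using (∈-allFin; ∈-upTo⁺; ∈-concatMap⁺; ∈-map⁺; ∈-filter⁺; ∈-filter⁻; ∈-lookup)
import Data.List.Relation.Unary.All as All
open import Data.List.Relation.Unary.AllPairs using (_∷_)
open import Data.List.Relation.Unary.Any as Any using (here; there)
open import Data.List.Relation.Unary.Any.Properties using (lookup-index)
open import Data.List.Relation.Unary.Unique.Propositional using (Unique)
open import Data.List.Relation.Unary.Unique.Propositional.Properties using (allFin⁺; filter⁺)
open import Data.Nat.Base as ℕ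
  using (ℕ; zero; suc; _≤_; _<_; _+_; _*_; _^_; _⊔_; z≤n; s≤s)
open import Data.Nat.ListAction using (sum)
open import Data.Nat.Properties as ℕ using (m≤m⊔n; m≤n⊔m)
open import Data.Nat.Solver using () renaming (module +-*-Solver to ℕ-Solver)
open import Data.Product.Base using (∃; Σ; _×_; _,_; proj₁; proj₂; uncurry; curry)
import Data.Product.Properties as Product
open import Data.Rational.Base as ℚ using (ℚ; mkℚ; 0ℚ; 1ℚ; ½; _/_; toℚᵘ; *<*)
import Data.Rational.Properties as ℚ
open import Data.Rational.Solver using () renaming (module +-*-Solver to ℚ-Solver)
open import Data.Rational.Unnormalised.Base as ℚᵘ using (mkℚᵘ; *≤*; *≡*)
import Data.Rational.Unnormalised.Properties as ℚᵘ
open import Data.Refinement.Base using (_,_; value)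
open import Data.Refinement.Properties using (value-injective)
open import Data.Sum.Base using (inj₁; inj₂)
open import Data.Vec.Base as Vec using (Vec; []; _∷_; _++_; lookup; tabulate)
open import Data.Vec.Properties
  using (lookup∘tabulate; tabulate∘lookup; tabulate-∘; lookup-map; lookup-++ˡ; lookup-++ʳ)
open import Function.Base using (_∘_; id)
open import Function.Bundles using (Inverse; _↔_; mk↔ₛ′; _⇔_; mk⇔; Equivalence)
open import Function.Construct.Composition using (_↔-∘_)
open import Function.Construct.Symmetry using (↔-sym)
open import Level using (Level; 0ℓ)
open import Relation.Binary.Definitions using (DecidableEquality; tri<; tri≈; tri>)
open import Relation.Binary.PropositionalEquality
  using (_≡_; _≢_; refl; sym; trans; cong; cong₂; subst; subst₂; module ≡-Reasoning)
open import Relation.Nullary.Decidable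
  using (Dec; yes; no; does; recompute; decidable-stable; map′; ¬?; _×-dec_; _→-dec_)
open import Relation.Nullary.Negation using (¬_; contradiction)
open import Relation.Unary using (Pred; Decidable)

open Equivalence using (to; from)

-- A limit here is a concrete real, so no case distinction behind convergence may depend on `n`.
-- This matters for the frequencies of ball types: a complete list of candidate balls is easily
-- produced only as a list of labelled graphs, where isomorphic copies recur and many entries are
-- not balls of the right kind. A vertex is therefore given the least index of a graph isomorphic to
-- its ball.
--
-- The bound 2r + 1, rather than 2r, makes the balls not only disjoint but also free of edges
-- between them.
--
-- Satisfaction is classical and membership in an induced subgraph is irrelevant, so neither yields
-- a witness directly. In arbitrary graphs witnesses are used only towards a contradiction or a
-- stable goal; in finite graphs they are recovered by decision procedures.

private
  variable
    ℓ ℓ′ : Level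
    A B C : Set ℓ
    P : Set ℓ
    Q : Set ℓ′
    p : ℕ

-- Rational estimates

gap : ℚ → ℚ → ℚ
gap p q = ℚ.∣ p ℚ.- q ∣

gap-self : ∀ p → gap p p ≡ 0ℚ
gap-self p = cong ℚ.∣_∣ (ℚ.+-inverseʳ p)

gap-sym : ∀ p q → gap p q ≡ gap q p
gap-sym p q = trans (sym (ℚ.∣-p∣≡∣p∣ (p ℚ.- q)))
  (cong ℚ.∣_∣ (solve 2 (λ p q → :- (p :- q) := q :- p) refl p q))
  where open ℚ-Solver

gap-triangle : ∀ p q r → gap p r ℚ.≤ gap p q ℚ.+ gap q r
gap-triangle p q r = subst (λ t → ℚ.∣ t ∣ ℚ.≤ gap p q ℚ.+ gap q r)
  (solve 3 (λ p q r → (p :- q) :+ (q :- r) := p :- r) refl p q r)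
  (ℚ.∣p+q∣≤∣p∣+∣q∣ (p ℚ.- q) (q ℚ.- r))
  where open ℚ-Solver

gap-+ : ∀ p q p′ q′ → gap (p ℚ.+ q) (p′ ℚ.+ q′) ℚ.≤ gap p p′ ℚ.+ gap q q′
gap-+ p q p′ q′ = subst (λ t → ℚ.∣ t ∣ ℚ.≤ gap p p′ ℚ.+ gap q q′)
  (solve 4 (λ p q p′ q′ → (p :- p′) :+ (q :- q′) := (p :+ q) :- (p′ :+ q′))
    refl p q p′ q′)
  (ℚ.∣p+q∣≤∣p∣+∣q∣ (p ℚ.- p′) (q ℚ.- q′))
  where open ℚ-Solver

UnitBounded : ℚ → Set
UnitBounded p = ℚ.∣ p ∣ ℚ.≤ 1ℚ

∣p*q∣≤∣q∣ : ∀ p q → UnitBounded p → ℚ.∣ p ℚ.* q ∣ ℚ.≤ ℚ.∣ q ∣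
∣p*q∣≤∣q∣ p q p≤1 = begin
  ℚ.∣ p ℚ.* q ∣          ≡⟨ ℚ.∣p*q∣≡∣p∣*∣q∣ p q ⟩
  ℚ.∣ p ∣ ℚ.* ℚ.∣ q ∣    ≤⟨ ℚ.*-monoʳ-≤-nonNeg ℚ.∣ q ∣ {{ℚ.∣-∣-nonNeg q}} p≤1 ⟩
  1ℚ ℚ.* ℚ.∣ q ∣         ≡⟨ ℚ.*-identityˡ ℚ.∣ q ∣ ⟩
  ℚ.∣ q ∣                ∎
  where open ℚ.≤-Reasoning

gap-* : ∀ p q p′ q′ → UnitBounded p → UnitBounded q′ →
        gap (p ℚ.* q) (p′ ℚ.* q′) ℚ.≤ gap p p′ ℚ.+ gap q q′
gap-* p q p′ q′ p≤1 q′≤1 = begin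
  gap (p ℚ.* q) (p′ ℚ.* q′)
    ≡⟨ cong ℚ.∣_∣ (solve 4 (λ p q p′ q′ →
         p :* q :- p′ :* q′ := q′ :* (p :- p′) :+ p :* (q :- q′)) refl p q p′ q′) ⟩
  ℚ.∣ q′ ℚ.* (p ℚ.- p′) ℚ.+ p ℚ.* (q ℚ.- q′) ∣
    ≤⟨ ℚ.∣p+q∣≤∣p∣+∣q∣ (q′ ℚ.* (p ℚ.- p′)) (p ℚ.* (q ℚ.- q′)) ⟩
  ℚ.∣ q′ ℚ.* (p ℚ.- p′) ∣ ℚ.+ ℚ.∣ p ℚ.* (q ℚ.- q′) ∣
    ≤⟨ ℚ.+-mono-≤ (∣p*q∣≤∣q∣ q′ (p ℚ.- p′) q′≤1) (∣p*q∣≤∣q∣ p (q ℚ.- q′) p≤1) ⟩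
  gap p p′ ℚ.+ gap q q′ ∎
  where open ℚ.≤-Reasoning
        open ℚ-Solver

gap-≤ : ∀ p q e → p ℚ.≤ q ℚ.+ e → q ℚ.≤ p ℚ.+ e → gap p q ℚ.≤ e
gap-≤ p q e p≤q+e q≤p+e with ℚ.∣p∣≡p∨∣p∣≡-p (p ℚ.- q)
... | inj₁ eq = subst₂ ℚ._≤_ (sym eq)
  (solve 2 (λ q e → (q :+ e) :- q := e) refl q e) (ℚ.+-monoˡ-≤ (ℚ.- q) p≤q+e)
  where open ℚ-Solver
... | inj₂ eq = subst₂ ℚ._≤_
  (trans (solve 2 (λ p q → q :- p := :- (p :- q)) refl p q) (sym eq))
  (solve 2 (λ p e → (p :+ e) :- p := e) refl p e) (ℚ.+-monoˡ-≤ (ℚ.- p) q≤p+e)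
  where open ℚ-Solver

half-pos : ∀ {ε} → 0ℚ ℚ.< ε → 0ℚ ℚ.< ½ ℚ.* ε
half-pos {ε} 0<ε = subst (ℚ._< ½ ℚ.* ε) (ℚ.*-zeroʳ ½) (ℚ.*-monoʳ-<-pos ½ 0<ε)

half+half : ∀ ε → ½ ℚ.* ε ℚ.+ ½ ℚ.* ε ≡ ε
half+half ε = trans (sym (ℚ.*-distribʳ-+ ε ½ ½)) (ℚ.*-identityˡ ε)

toℚᵘ-/ : ∀ i d → toℚᵘ (i / suc d) ℚᵘ.≃ mkℚᵘ i d
toℚᵘ-/ i d = ℚ.toℚᵘ-fromℚᵘ (mkℚᵘ i d)

/-mono-≤ : ∀ i j c d → i ℤ.* ℤ.+ suc d ℤ.≤ j ℤ.* ℤ.+ suc c → i / suc c ℚ.≤ j / suc d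
/-mono-≤ i j c d le = ℚ.toℚᵘ-cancel-≤ (begin
  toℚᵘ (i / suc c)  ≃⟨ toℚᵘ-/ i c ⟩
  mkℚᵘ i c          ≤⟨ *≤* le ⟩
  mkℚᵘ j d          ≃⟨ toℚᵘ-/ j d ⟨
  toℚᵘ (j / suc d)  ∎)
  where open ℚᵘ.≤-Reasoning

ratio-≤ : ∀ {k m l n} → l ℕ.* suc m ≤ k ℕ.* suc n → ratio l (suc n) ℚ.≤ ratio k (suc m)
ratio-≤ {k} {m} {l} {n} le = /-mono-≤ (ℤ.+ l) (ℤ.+ k) n m
  (subst₂ ℤ._≤_ (ℤ.pos-* l (suc m)) (ℤ.pos-* k (suc n)) (ℤ.+≤+ le))

ratio-mono : ∀ {k l} n → k ≤ l → ratio k n ℚ.≤ ratio l n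
ratio-mono zero    k≤l = ℚ.≤-refl
ratio-mono {k} {l} (suc n) k≤l = ratio-≤ {l} {n} {k} {n} (ℕ.*-monoˡ-≤ (suc n) k≤l)

ratio-+ : ∀ k l n → ratio (k ℕ.+ l) n ≡ ratio k n ℚ.+ ratio l n
ratio-+ k l zero    = refl
ratio-+ k l (suc n) = ℚ.toℚᵘ-injective (begin-equality
  toℚᵘ (ℤ.+ (k ℕ.+ l) / suc n)                   ≃⟨ toℚᵘ-/ (ℤ.+ (k ℕ.+ l)) n ⟩
  mkℚᵘ (ℤ.+ (k ℕ.+ l)) n                         ≃⟨ *≡* eq ⟩
  mkℚᵘ (ℤ.+ k) n ℚᵘ.+ mkℚᵘ (ℤ.+ l) n             ≃⟨ ℚᵘ.+-cong (toℚᵘ-/ (ℤ.+ k) n) (toℚᵘ-/ (ℤ.+ l) n) ⟨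
  toℚᵘ (ℤ.+ k / suc n) ℚᵘ.+ toℚᵘ (ℤ.+ l / suc n) ≃⟨ ℚ.toℚᵘ-homo-+ (ℤ.+ k / suc n) (ℤ.+ l / suc n) ⟨
  toℚᵘ ((ℤ.+ k / suc n) ℚ.+ (ℤ.+ l / suc n))     ∎)
  where
  open ℚᵘ.≤-Reasoning
  s = ℤ.+ suc n
  eq : ℤ.+ (k ℕ.+ l) ℤ.* (s ℤ.* s) ≡ (ℤ.+ k ℤ.* s ℤ.+ ℤ.+ l ℤ.* s) ℤ.* s
  eq = trans (sym (ℤ.*-assoc (ℤ.+ (k ℕ.+ l)) s s))
         (cong (ℤ._* s) (ℤ.*-distribʳ-+ s (ℤ.+ k) (ℤ.+ l)))

ratio-* : ∀ k l m n → ratio (k ℕ.* l) (m ℕ.* n) ≡ ratio k m ℚ.* ratio l n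
ratio-* k l zero    n       = sym (ℚ.*-zeroˡ (ratio l n))
ratio-* k l (suc m) zero    = trans (cong (ratio (k ℕ.* l)) (ℕ.*-zeroʳ m))
                                    (sym (ℚ.*-zeroʳ (ratio k (suc m))))
ratio-* k l (suc m) (suc n) = ℚ.toℚᵘ-injective (begin-equality
  toℚᵘ (ℤ.+ (k ℕ.* l) / (suc m ℕ.* suc n))       ≃⟨ toℚᵘ-/ (ℤ.+ (k ℕ.* l)) _ ⟩
  mkℚᵘ (ℤ.+ (k ℕ.* l)) (n ℕ.+ m ℕ.* suc n)       ≡⟨ cong (λ z → mkℚᵘ z (n ℕ.+ m ℕ.* suc n)) (ℤ.pos-* k l) ⟩
  mkℚᵘ (ℤ.+ k) m ℚᵘ.* mkℚᵘ (ℤ.+ l) n             ≃⟨ ℚᵘ.*-cong (toℚᵘ-/ (ℤ.+ k) m) (toℚᵘ-/ (ℤ.+ l) n) ⟨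
  toℚᵘ (ℤ.+ k / suc m) ℚᵘ.* toℚᵘ (ℤ.+ l / suc n) ≃⟨ ℚ.toℚᵘ-homo-* (ℤ.+ k / suc m) (ℤ.+ l / suc n) ⟨
  toℚᵘ ((ℤ.+ k / suc m) ℚ.* (ℤ.+ l / suc n))     ∎)
  where open ℚᵘ.≤-Reasoning

ratio-0 : ∀ n → ratio 0 n ≡ 0ℚ
ratio-0 zero    = refl
ratio-0 (suc n) = ℚ.toℚᵘ-injective (ℚᵘ.≃-trans (toℚᵘ-/ (ℤ.+ 0) n) (*≡* refl))

0≤ratio : ∀ k n → 0ℚ ℚ.≤ ratio k n
0≤ratio k n = subst (ℚ._≤ ratio k n) (ratio-0 n) (ratio-mono n z≤n)

-- At `n` zero the default value of `ratio` would make the right side too small, hence the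
-- positivity hypothesis; at `m` zero it only shrinks the left side.
ratio-≤′ : ∀ {B C m n} → 0 < n → n * B ≤ C * m → ratio B m ℚ.≤ ratio C n
ratio-≤′ {B} {C} {zero}  {n}     _ _  = 0≤ratio C n
ratio-≤′ {B} {C} {suc m} {suc n} _ le = ratio-≤ {C} {n} {B} {m} (subst (_≤ C * suc m) (ℕ.*-comm (suc n) B) le)

ratio-unitBounded : ∀ {k n} → k ≤ n → UnitBounded (ratio k n)
ratio-unitBounded {k} {n} k≤n =
  subst (ℚ._≤ 1ℚ) (sym (ℚ.0≤p⇒∣p∣≡p (0≤ratio k n))) (≤1 n k≤n)
  where
  ≤1 : ∀ n → k ≤ n → ratio k n ℚ.≤ 1ℚ
  ≤1 zero    _   = ℚ.nonNegative⁻¹ 1ℚ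
  ≤1 (suc n) k≤n = ratio-≤ {1} {0} {k} {n}
    (subst₂ _≤_ (sym (ℕ.*-identityʳ k)) (sym (ℕ.*-identityˡ (suc n))) k≤n)

ratio-gap : ∀ {x y z} n → x ≤ y ℕ.+ z → y ≤ x ℕ.+ z →
            gap (ratio x n) (ratio y n) ℚ.≤ ratio z n
ratio-gap {x} {y} {z} n x≤ y≤ = gap-≤ (ratio x n) (ratio y n) (ratio z n)
  (subst (ratio x n ℚ.≤_) (ratio-+ y z n) (ratio-mono n x≤))
  (subst (ratio y n ℚ.≤_) (ratio-+ x z n) (ratio-mono n y≤))

-- For ε = (k+1)/(d+1) the witness C (d+1) works because C (d+1) ≤ n gives
-- C / n ≤ 1 / (d+1) ≤ ε.
ratio-vanishes : ∀ C ε → 0ℚ ℚ.< ε → ∃ λ N → ∀ n → N ≤ n → ratio C n ℚ.≤ ε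
ratio-vanishes C ε@(mkℚ +[1+ k ] d c) _ = C ℕ.* suc d , go
  where
  go : ∀ n → C ℕ.* suc d ≤ n → ratio C n ℚ.≤ ε
  go zero    _ = ℚ.nonNegative⁻¹ ε
  go (suc n) le = subst (ratio C (suc n) ℚ.≤_) (ℚ.fromℚᵘ-toℚᵘ ε)
    (ratio-≤ {suc k} {d} {C} {n} (ℕ.≤-trans le (ℕ.m≤m+n (suc n) (k ℕ.* suc n))))
ratio-vanishes C (mkℚ (ℤ.+ 0)    d c) (*<* lt) with () ← ℤ.<-irrefl (sym (ℤ.*-zeroˡ (ℤ.+ 1))) lt
ratio-vanishes C (mkℚ -[1+ k ] d c) (*<* ())

-- Cauchy sequences

Cauchy : (ℕ → ℚ) → Set
Cauchy a = ∀ ε → 0ℚ ℚ.< ε → ∃ λ N → ∀ m n → N ≤ m → N ≤ n → gap (a m) (a n) ℚ.≤ ε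

1/suc-pos : ∀ k → 0ℚ ℚ.< ℤ.+ 1 / suc k
1/suc-pos k = ℚ.toℚᵘ-cancel-< (ℚᵘ.<-respʳ-≃ (ℚᵘ.≃-sym (toℚᵘ-/ (ℤ.+ 1) k)) (ℚᵘ.positive⁻¹ (mkℚᵘ (ℤ.+ 1) k)))

Cauchy⇒Converges : ∀ {a} → Cauchy a → Converges a
Cauchy⇒Converges {a} cauchy = x , lim
  where
  modulus : ℕ → ℕ
  modulus k = proj₁ (cauchy (ℤ.+ 1 / suc k) (1/suc-pos k))

  near : ∀ k m n → modulus k ≤ m → modulus k ≤ n → gap (a m) (a n) ℚ.≤ ℤ.+ 1 / suc k
  near k = proj₂ (cauchy (ℤ.+ 1 / suc k) (1/suc-pos k))

  x : ℝ
  x .approx k = a (modulus k)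
  -- `modulus` need not be monotone. Whichever of its two values is smaller supplies the bound for
  -- both indices, and the other summand is slack.
  x .regular m n with ℕ.≤-total (modulus m) (modulus n)
  ... | inj₁ m≤n = ℚ.≤-trans (near m _ _ ℕ.≤-refl m≤n)
    (subst (ℚ._≤ (ℤ.+ 1 / suc m) ℚ.+ (ℤ.+ 1 / suc n)) (ℚ.+-identityʳ (ℤ.+ 1 / suc m))
      (ℚ.+-monoʳ-≤ (ℤ.+ 1 / suc m) (ℚ.<⇒≤ (1/suc-pos n))))
  ... | inj₂ n≤m = ℚ.≤-trans (near n _ _ n≤m ℕ.≤-refl)
    (subst (ℚ._≤ (ℤ.+ 1 / suc m) ℚ.+ (ℤ.+ 1 / suc n)) (ℚ.+-identityˡ (ℤ.+ 1 / suc n))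
      (ℚ.+-monoˡ-≤ (ℤ.+ 1 / suc n) (ℚ.<⇒≤ (1/suc-pos m))))

  lim : a ⟶ x
  lim ε 0<ε = let (N , close) = cauchy ε 0<ε in N , λ n N≤n k →
    ℚ.≤-trans (gap-triangle (a n) (a (N ⊔ modulus k)) (a (modulus k)))
      (ℚ.+-mono-≤ (close n (N ⊔ modulus k) N≤n (m≤m⊔n N (modulus k)))
                  (near k (N ⊔ modulus k) (modulus k) (m≤n⊔m N (modulus k)) ℕ.≤-refl))

-- `Within` bounds the distance to every approximation of the limit, so a single rational
-- `approx x K` can stand in for it: a quarter of `ε` comes from the limit and a quarter from the
-- error 1/(K+1), for each of the two terms.
Converges⇒Cauchy : ∀ {a} → Converges a → Cauchy a
Converges⇒Cauchy {a} (x , lim) ε 0<ε = M , close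
  where
  δ = ½ ℚ.* (½ ℚ.* ε)
  0<δ : 0ℚ ℚ.< δ
  0<δ = half-pos (half-pos 0<ε)
  M = proj₁ (lim δ 0<δ)
  K = proj₁ (ratio-vanishes 1 δ 0<δ)

  near : ∀ n → M ≤ n → gap (a n) (approx x K) ℚ.≤ ½ ℚ.* ε
  near n M≤n = begin
    gap (a n) (approx x K)  ≤⟨ proj₂ (lim δ 0<δ) n M≤n K ⟩
    δ ℚ.+ (ℤ.+ 1 / suc K)   ≤⟨ ℚ.+-monoʳ-≤ δ (proj₂ (ratio-vanishes 1 δ 0<δ) (suc K) (ℕ.n≤1+n K)) ⟩
    δ ℚ.+ δ                 ≡⟨ half+half (½ ℚ.* ε) ⟩
    ½ ℚ.* ε                 ∎
    where open ℚ.≤-Reasoning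

  close : ∀ m n → M ≤ m → M ≤ n → gap (a m) (a n) ℚ.≤ ε
  close m n M≤m M≤n = begin
    gap (a m) (a n)
      ≤⟨ gap-triangle (a m) (approx x K) (a n) ⟩
    gap (a m) (approx x K) ℚ.+ gap (approx x K) (a n)
      ≤⟨ ℚ.+-mono-≤ (near m M≤m) (subst (ℚ._≤ ½ ℚ.* ε) (gap-sym (a n) (approx x K)) (near n M≤n)) ⟩
    ½ ℚ.* ε ℚ.+ ½ ℚ.* ε
      ≡⟨ half+half ε ⟩
    ε ∎
    where open ℚ.≤-Reasoning

Cauchy-cong : ∀ {a b} → (∀ n → a n ≡ b n) → Cauchy a → Cauchy b
Cauchy-cong a≡b ca ε 0<ε = let (N , close) = ca ε 0<ε in
  N , λ m n N≤m N≤n → subst₂ (λ p q → gap p q ℚ.≤ ε) (a≡b m) (a≡b n) (close m n N≤m N≤n)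

Cauchy-const : ∀ p → Cauchy (λ _ → p)
Cauchy-const p ε 0<ε = 0 , λ _ _ _ _ → subst (ℚ._≤ ε) (sym (gap-self p)) (ℚ.<⇒≤ 0<ε)

Cauchy-combine : ∀ {a b c} →
  (∀ m n → gap (c m) (c n) ℚ.≤ gap (a m) (a n) ℚ.+ gap (b m) (b n)) →
  Cauchy a → Cauchy b → Cauchy c
Cauchy-combine {a} {b} {c} split ca cb ε 0<ε =
  let (M , closeᵃ) = ca (½ ℚ.* ε) (half-pos 0<ε)
      (N , closeᵇ) = cb (½ ℚ.* ε) (half-pos 0<ε)
  in M ⊔ N , λ m n ≤m ≤n → begin
    gap (c m) (c n)
      ≤⟨ split m n ⟩
    gap (a m) (a n) ℚ.+ gap (b m) (b n)
      ≤⟨ ℚ.+-mono-≤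
           (closeᵃ m n (ℕ.≤-trans (m≤m⊔n M N) ≤m) (ℕ.≤-trans (m≤m⊔n M N) ≤n))
           (closeᵇ m n (ℕ.≤-trans (m≤n⊔m M N) ≤m) (ℕ.≤-trans (m≤n⊔m M N) ≤n)) ⟩
    ½ ℚ.* ε ℚ.+ ½ ℚ.* ε
      ≡⟨ half+half ε ⟩
    ε ∎
  where open ℚ.≤-Reasoning

Cauchy-+ : ∀ {a b} → Cauchy a → Cauchy b → Cauchy (λ n → a n ℚ.+ b n)
Cauchy-+ {a} {b} = Cauchy-combine {a} {b} {λ n → a n ℚ.+ b n} (λ m n → gap-+ (a m) (b m) (a n) (b n))

Cauchy-* : ∀ {a b} → (∀ n → UnitBounded (a n)) → (∀ n → UnitBounded (b n)) →
           Cauchy a → Cauchy b → Cauchy (λ n → a n ℚ.* b n)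
Cauchy-* {a} {b} a≤1 b≤1 =
  Cauchy-combine {a} {b} {λ n → a n ℚ.* b n} (λ m n → gap-* (a m) (b m) (a n) (b n) (a≤1 m) (b≤1 n))

Cauchy-near : ∀ {a b} →
  (∀ ε → 0ℚ ℚ.< ε → ∃ λ N → ∀ n → N ≤ n → gap (a n) (b n) ℚ.≤ ε) →
  Cauchy b → Cauchy a
Cauchy-near {a} {b} a≈b cb ε 0<ε =
  let δ = ½ ℚ.* ε
      0<δ = half-pos 0<ε
      (M , near)  = a≈b (½ ℚ.* δ) (half-pos 0<δ)
      (N , close) = cb δ 0<δ
  in M ⊔ N , λ m n ≤m ≤n →
    let nearₘ = near m (ℕ.≤-trans (m≤m⊔n M N) ≤m)
        nearₙ = subst (ℚ._≤ ½ ℚ.* δ) (gap-sym (a n) (b n)) (near n (ℕ.≤-trans (m≤m⊔n M N) ≤n))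
        closeₘₙ = close m n (ℕ.≤-trans (m≤n⊔m M N) ≤m) (ℕ.≤-trans (m≤n⊔m M N) ≤n)
    in begin
    gap (a m) (a n)
      ≤⟨ gap-triangle (a m) (b m) (a n) ⟩
    gap (a m) (b m) ℚ.+ gap (b m) (a n)
      ≤⟨ ℚ.+-mono-≤ nearₘ (ℚ.≤-trans (gap-triangle (b m) (b n) (a n)) (ℚ.+-mono-≤ closeₘₙ nearₙ)) ⟩
    ½ ℚ.* δ ℚ.+ (δ ℚ.+ ½ ℚ.* δ)
      ≡⟨ solve 2 (λ h d → h :+ (d :+ h) := d :+ (h :+ h)) refl (½ ℚ.* δ) δ ⟩
    δ ℚ.+ (½ ℚ.* δ ℚ.+ ½ ℚ.* δ)
      ≡⟨ cong (δ ℚ.+_) (half+half δ) ⟩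
    δ ℚ.+ δ
      ≡⟨ half+half ε ⟩
    ε ∎
  where open ℚ.≤-Reasoning
        open ℚ-Solver

-- Counting with indicator sums

⟦_⟧ : Dec P → ℕ
⟦ yes _ ⟧ = 1
⟦ no  _ ⟧ = 0

⟦⟧-mono : (P? : Dec P) (Q? : Dec Q) → (P → Q) → ⟦ P? ⟧ ≤ ⟦ Q? ⟧
⟦⟧-mono (no _)  _        f = z≤n
⟦⟧-mono (yes p) (yes _)  f = ℕ.≤-refl
⟦⟧-mono (yes p) (no ¬q)  f = contradiction (f p) ¬q

⟦⟧-cong : (P? : Dec P) (Q? : Dec Q) → P ⇔ Q → ⟦ P? ⟧ ≡ ⟦ Q? ⟧
⟦⟧-cong P? Q? e = ℕ.≤-antisym (⟦⟧-mono P? Q? (Equivalence.to e)) (⟦⟧-mono Q? P? (Equivalence.from e))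

⟦⟧-true : (P? : Dec P) → P → ⟦ P? ⟧ ≡ 1
⟦⟧-true (yes _) _ = refl
⟦⟧-true (no ¬p) p = contradiction p ¬p

⟦⟧-false : (P? : Dec P) → ¬ P → ⟦ P? ⟧ ≡ 0
⟦⟧-false (yes p) ¬p = contradiction p ¬p
⟦⟧-false (no _)  _  = refl

⟦⟧≤1 : (P? : Dec P) → ⟦ P? ⟧ ≤ 1
⟦⟧≤1 (yes _) = ℕ.≤-refl
⟦⟧≤1 (no _)  = z≤n

∑ : List A → (A → ℕ) → ℕ
∑ xs f = sum (List.map f xs)

∑-cong : (xs : List A) {f g : A → ℕ} → (∀ x → f x ≡ g x) → ∑ xs f ≡ ∑ xs g
∑-cong xs f≡g = cong sum (List.map-cong f≡g xs)

∑-mono : (xs : List A) {f g : A → ℕ} → (∀ x → f x ≤ g x) → ∑ xs f ≤ ∑ xs g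
∑-mono []       f≤g = z≤n
∑-mono (x ∷ xs) f≤g = ℕ.+-mono-≤ (f≤g x) (∑-mono xs f≤g)

∑-+ : (xs : List A) (f g : A → ℕ) → ∑ xs (λ x → f x + g x) ≡ ∑ xs f + ∑ xs g
∑-+ []       f g = refl
∑-+ (x ∷ xs) f g = trans (cong (f x + g x +_) (∑-+ xs f g))
  (solve 4 (λ a b c d → a :+ b :+ (c :+ d) := a :+ c :+ (b :+ d)) refl
    (f x) (g x) (∑ xs f) (∑ xs g))
  where open ℕ-Solver

∑-const : (xs : List A) (c : ℕ) → ∑ xs (λ _ → c) ≡ length xs * c
∑-const []       c = refl
∑-const (x ∷ xs) c = cong (c +_) (∑-const xs c)

∑-*ˡ : (xs : List A) (c : ℕ) (f : A → ℕ) → ∑ xs (λ x → c * f x) ≡ c * ∑ xs f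
∑-*ˡ []       c f = sym (ℕ.*-zeroʳ c)
∑-*ˡ (x ∷ xs) c f = trans (cong (c * f x +_) (∑-*ˡ xs c f)) (sym (ℕ.*-distribˡ-+ c (f x) (∑ xs f)))

∑-*ʳ : (xs : List A) (c : ℕ) (f : A → ℕ) → ∑ xs (λ x → f x * c) ≡ ∑ xs f * c
∑-*ʳ []       c f = refl
∑-*ʳ (x ∷ xs) c f = trans (cong (f x * c +_) (∑-*ʳ xs c f)) (sym (ℕ.*-distribʳ-+ c (f x) (∑ xs f)))

∑-swap : (xs : List A) (ys : List B) (f : A → B → ℕ) →
         ∑ xs (λ x → ∑ ys (f x)) ≡ ∑ ys (λ y → ∑ xs (λ x → f x y))
∑-swap []       ys f = sym (trans (∑-const ys 0) (ℕ.*-zeroʳ (length ys)))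
∑-swap (x ∷ xs) ys f = trans (cong (∑ ys (f x) +_) (∑-swap xs ys f))
  (sym (∑-+ ys (f x) (λ y → ∑ xs (λ x → f x y))))

∑-map : (xs : List A) (h : A → B) (f : B → ℕ) → ∑ (List.map h xs) f ≡ ∑ xs (f ∘ h)
∑-map xs h f = cong sum (sym (List.map-∘ xs))

∑-++ : (xs ys : List A) (f : A → ℕ) → ∑ (xs List.++ ys) f ≡ ∑ xs f + ∑ ys f
∑-++ []       ys f = refl
∑-++ (x ∷ xs) ys f = trans (cong (f x +_) (∑-++ xs ys f)) (sym (ℕ.+-assoc (f x) (∑ xs f) (∑ ys f)))

∑-cartesianProductWith : (h : A → B → C) (xs : List A) (ys : List B) (f : C → ℕ) →
  ∑ (cartesianProductWith h xs ys) f ≡ ∑ xs (λ x → ∑ ys (λ y → f (h x y)))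
∑-cartesianProductWith h []       ys f = refl
∑-cartesianProductWith h (x ∷ xs) ys f =
  trans (∑-++ (List.map (h x) ys) (cartesianProductWith h xs ys) f)
    (cong₂ _+_ (∑-map ys (h x) f) (∑-cartesianProductWith h xs ys f))

∈⇒≤∑ : {xs : List A} (f : A → ℕ) {x : A} → x ∈ xs → f x ≤ ∑ xs f
∈⇒≤∑ {xs = x ∷ xs} f (here refl) = ℕ.m≤m+n (f x) (∑ xs f)
∈⇒≤∑ {xs = x ∷ xs} f (there x∈)  = ℕ.≤-trans (∈⇒≤∑ f x∈) (ℕ.m≤n+m (∑ xs f) (f x))

-- Densities and degrees are defined as lengths of filtered lists; as sums they become open to
-- double counting through `∑-swap`.
length-filter-∑ : {P : Pred A ℓ} (P? : Decidable P) (xs : List A) →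
                  length (filter P? xs) ≡ ∑ xs (λ x → ⟦ P? x ⟧)
length-filter-∑ P? []       = refl
length-filter-∑ P? (x ∷ xs) with P? x
... | yes _ = cong suc (length-filter-∑ P? xs)
... | no  _ = length-filter-∑ P? xs

∑-allFin-suc : ∀ n (f : Fin (suc n) → ℕ) → ∑ (allFin (suc n)) f ≡ f zero + ∑ (allFin n) (f ∘ suc)
∑-allFin-suc n f = cong (f zero +_)
  (trans (cong (λ xs → ∑ xs f) (sym (List.map-tabulate (λ i → i) suc))) (∑-map (allFin n) suc f))

-- A Kronecker delta. Inserting it and exchanging the sums regroups a sum by the values of a
-- function, as in `∑-injective` and `typeSum-suc`.
∑-allFin-≡ : ∀ {n} (i : Fin n) (f : Fin n → ℕ) → ∑ (allFin n) (λ j → ⟦ i Fin.≟ j ⟧ * f j) ≡ f i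
∑-allFin-≡ {suc n} zero f = trans (∑-allFin-suc n _)
  (trans (cong₂ _+_ (ℕ.*-identityˡ (f zero))
    (trans (∑-cong (allFin n) {g = λ _ → 0} λ j → refl)
      (trans (∑-const (allFin n) 0) (ℕ.*-zeroʳ (length (allFin n))))))
    (ℕ.+-identityʳ (f zero)))
∑-allFin-≡ {suc n} (suc i) f = trans (∑-allFin-suc n (λ j → ⟦ suc i Fin.≟ j ⟧ * f j))
  (trans (∑-cong (allFin n) λ j →
            cong (_* f (suc j)) (⟦⟧-cong (suc i Fin.≟ suc j) (i Fin.≟ j)
              (mk⇔ Fin.suc-injective (cong suc))))
    (∑-allFin-≡ i (f ∘ suc)))

length-allFin : ∀ n → length (allFin n) ≡ n
length-allFin n = List.length-tabulate {n = n} (λ i → i)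

length-∑ : (xs : List A) → length xs ≡ ∑ xs (λ _ → 1)
length-∑ xs = sym (trans (∑-const xs 1) (ℕ.*-identityʳ (length xs)))

length-tuples : ∀ n p → length (tuples n p) ≡ n ^ p
length-tuples n zero    = refl
length-tuples n (suc p) = begin
  length (tuples n (suc p))                     ≡⟨ length-∑ (tuples n (suc p)) ⟩
  ∑ (tuples n (suc p)) (λ _ → 1)                ≡⟨ ∑-cartesianProductWith _ (allFin n) (tuples n p) _ ⟩
  ∑ (allFin n) (λ _ → ∑ (tuples n p) (λ _ → 1)) ≡⟨ ∑-const (allFin n) _ ⟩
  length (allFin n) * ∑ (tuples n p) (λ _ → 1)  ≡⟨ cong₂ _*_ (length-allFin n) (sym (length-∑ (tuples n p))) ⟩
  n * length (tuples n p)                       ≡⟨ cong (n *_) (length-tuples n p) ⟩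
  n * n ^ p                                     ∎
  where open ≡-Reasoning

Cauchy-∑ : ∀ {a} {A : Set a} (xs : List A) (f : A → ℕ → ℕ) (m : ℕ → ℕ) →
           (∀ x → Cauchy (λ n → ratio (f x n) (m n))) →
           Cauchy (λ n → ratio (∑ xs (λ x → f x n)) (m n))
Cauchy-∑ []       f m c =
  Cauchy-cong {λ _ → 0ℚ} {λ n → ratio 0 (m n)} (λ n → sym (ratio-0 (m n))) (Cauchy-const 0ℚ)
Cauchy-∑ (x ∷ xs) f m c =
  Cauchy-cong {λ n → ratio (f x n) (m n) ℚ.+ ratio (∑ xs (λ x → f x n)) (m n)}
    {λ n → ratio (∑ (x ∷ xs) (λ x → f x n)) (m n)}
    (λ n → sym (ratio-+ (f x n) (∑ xs (λ x → f x n)) (m n)))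
    (Cauchy-+ {λ n → ratio (f x n) (m n)} {λ n → ratio (∑ xs (λ x → f x n)) (m n)} (c x) (Cauchy-∑ xs f m c))

-- Bounded degree bounds the size of balls

-- An endpoint is counted once for each neighbour of `v` that can serve as first step. There are at
-- most `d` such neighbours, and induction bounds the endpoints reached from each.
walks-bound : ∀ {d} G → MaxDegree≤ d G → ∀ k v →
              ∑ (allFin (order G)) (λ w → ⟦ walk? G k v w ⟧) ≤ d ^ k
walks-bound G deg zero v = ℕ.≤-reflexive
  (trans (∑-cong (allFin (order G)) λ w → sym (ℕ.*-identityʳ ⟦ v Fin.≟ w ⟧))
    (∑-allFin-≡ v (λ _ → 1)))
walks-bound {d} G deg (suc k) v = begin
  ∑ vs (λ w → ⟦ walk? G (suc k) v w ⟧)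
    ≤⟨ ∑-mono vs first-step ⟩
  ∑ vs (λ w → ∑ vs (λ u → ⟦ T? (adj G v u) ⟧ * ⟦ walk? G k u w ⟧))
    ≡⟨ ∑-swap vs vs _ ⟩
  ∑ vs (λ u → ∑ vs (λ w → ⟦ T? (adj G v u) ⟧ * ⟦ walk? G k u w ⟧))
    ≡⟨ ∑-cong vs (λ u → ∑-*ˡ vs ⟦ T? (adj G v u) ⟧ _) ⟩
  ∑ vs (λ u → ⟦ T? (adj G v u) ⟧ * ∑ vs (λ w → ⟦ walk? G k u w ⟧))
    ≤⟨ ∑-mono vs (λ u → ℕ.*-monoʳ-≤ ⟦ T? (adj G v u) ⟧ (walks-bound G deg k u)) ⟩
  ∑ vs (λ u → ⟦ T? (adj G v u) ⟧ * d ^ k)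
    ≡⟨ ∑-*ʳ vs (d ^ k) _ ⟩
  ∑ vs (λ u → ⟦ T? (adj G v u) ⟧) * d ^ k
    ≡⟨ cong (_* d ^ k) (length-filter-∑ (λ u → T? (adj G v u)) vs) ⟨
  degree G v * d ^ k
    ≤⟨ ℕ.*-monoˡ-≤ (d ^ k) (deg v) ⟩
  d * d ^ k ∎
  where
  open ℕ.≤-Reasoning
  vs = allFin (order G)
  first-step : ∀ w → ⟦ walk? G (suc k) v w ⟧ ≤ ∑ vs (λ u → ⟦ T? (adj G v u) ⟧ * ⟦ walk? G k u w ⟧)
  first-step w with walk? G (suc k) v w
  ... | no _ = z≤n
  ... | yes (u , v~u , uw) = subst (_≤ ∑ vs (λ u → ⟦ T? (adj G v u) ⟧ * ⟦ walk? G k u w ⟧))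
    (cong₂ _*_ (⟦⟧-true (T? (adj G v u)) v~u) (⟦⟧-true (walk? G k u w) uw))
    (∈⇒≤∑ (λ u → ⟦ T? (adj G v u) ⟧ * ⟦ walk? G k u w ⟧) (∈-allFin u))

ballBound : ℕ → ℕ → ℕ
ballBound d r = ∑ (upTo (suc r)) (d ^_)

ball-bound : ∀ {d} G → MaxDegree≤ d G → ∀ r v →
             ∑ (allFin (order G)) (λ w → ⟦ dist≤? G r v w ⟧) ≤ ballBound d r
ball-bound {d} G deg r v = begin
  ∑ vs (λ w → ⟦ dist≤? G r v w ⟧)
    ≤⟨ ∑-mono vs at-some-length ⟩
  ∑ vs (λ w → ∑ (upTo (suc r)) (λ k → ⟦ walk? G k v w ⟧))
    ≡⟨ ∑-swap vs (upTo (suc r)) _ ⟩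
  ∑ (upTo (suc r)) (λ k → ∑ vs (λ w → ⟦ walk? G k v w ⟧))
    ≤⟨ ∑-mono (upTo (suc r)) (λ k → walks-bound G deg k v) ⟩
  ballBound d r ∎
  where
  open ℕ.≤-Reasoning
  vs = allFin (order G)
  at-some-length : ∀ w → ⟦ dist≤? G r v w ⟧ ≤ ∑ (upTo (suc r)) (λ k → ⟦ walk? G k v w ⟧)
  at-some-length w with dist≤? G r v w
  ... | no _ = z≤n
  ... | yes (k , k≤r , vw) = subst (_≤ ∑ (upTo (suc r)) _)
    (⟦⟧-true (walk? G k v w) vw) (∈⇒≤∑ (λ k → ⟦ walk? G k v w ⟧) (∈-upTo⁺ (s≤s k≤r)))

-- Walks

dist-refl : ∀ G {k u} → Dist≤ G k u u
dist-refl G = 0 , z≤n , refl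

dist-cons : ∀ G {k u v w} → Graph._~_ G u v → Dist≤ G k v w → Dist≤ G (suc k) u w
dist-cons G {v = v} u~v (i , i≤k , vw) = suc i , s≤s i≤k , v , u~v , vw

walk-++ : ∀ G j {k u v w} → Walk G j u v → Walk G k v w → Walk G (j + k) u w
walk-++ G zero    refl          vw = vw
walk-++ G (suc j) (x , u~x , xv) vw = x , u~x , walk-++ G j xv vw

walk-reverse : ∀ G k {u v} → Walk G k u v → Walk G k v u
walk-reverse G zero    refl = refl
walk-reverse G (suc k) {u} {v} (x , u~x , xv) = subst (λ n → Walk G n v u) (ℕ.+-comm k 1)
  (walk-++ G k (walk-reverse G k xv) (u , Graph.~-sym G u~x , refl))

dist-trans : ∀ G {j k u v w} → Dist≤ G j u v → Dist≤ G k v w → Dist≤ G (j + k) u w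
dist-trans G (a , a≤j , uv) (b , b≤k , vw) = a + b , ℕ.+-mono-≤ a≤j b≤k , walk-++ G a uv vw

dist-sym : ∀ G {k u v} → Dist≤ G k u v → Dist≤ G k v u
dist-sym G (a , a≤k , uv) = a , a≤k , walk-reverse G a uv

-- Since `within` speaks of everything reachable in at most `k` steps and not only of the vertices
-- of `vw`, it passes to the tail of the walk by prepending the first edge.
walk-induced : ∀ G (W : Pred (V G) 0ℓ) k {v w} →
  (within : ∀ j u → j ≤ k → Walk G j v u → W u) (vw : Walk G k v w) →
  Walk (induced G W) k (v , [ within 0 v z≤n refl ]) (w , [ within k w ℕ.≤-refl vw ])
walk-induced G W zero    within refl = refl
walk-induced G W (suc k) within (x , v~x , xw) =
  (x , [ within 1 x (s≤s z≤n) (x , v~x , refl) ]) , v~x ,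
  walk-induced G W k (λ j u j≤k xu → within (suc j) u (s≤s j≤k) (x , v~x , xu)) xw

dist-induced : ∀ G (W : Pred (V G) 0ℓ) r {v w} → (within : ∀ u → Dist≤ G r v u → W u)
  (vw : Dist≤ G r v w) →
  Dist≤ (induced G W) r (v , [ within v (dist-refl G) ]) (w , [ within w vw ])
dist-induced G W r within (k , k≤r , vw) = k , k≤r ,
  walk-induced G W k (λ j u j≤k vu → within u (j , ℕ.≤-trans j≤k k≤r , vu)) vw

-- Satisfaction

⊨-stable : ∀ G (φ : Formula p) ρ → ¬ ¬ (G ⊨ φ [ ρ ]) → G ⊨ φ [ ρ ]
⊨-stable G (i ≐ j) ρ ¬¬s ¬s = ¬¬s λ s → s ¬s
⊨-stable G (i ∼ j) ρ ¬¬s ¬s = ¬¬s λ s → s ¬s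
⊨-stable G false   ρ ¬¬s = ¬¬s λ ()
⊨-stable G (φ ⊃ ψ) ρ ¬¬s t = ⊨-stable G ψ ρ λ ¬u → ¬¬s λ s → ¬u (s t)
⊨-stable G (all φ) ρ ¬¬s v = ⊨-stable G φ (v ∷ ρ) λ ¬u → ¬¬s λ s → ¬u (s v)

⇔-→ : ∀ {A B C D : Set} → A ⇔ B → C ⇔ D → (A → C) ⇔ (B → D)
⇔-→ A⇔B C⇔D = mk⇔ (λ f b → C⇔D .to (f (A⇔B .from b))) (λ g a → C⇔D .from (g (A⇔B .to a)))

⇔-¬ : ∀ {A B : Set} → A ⇔ B → (¬ A) ⇔ (¬ B)
⇔-¬ A⇔B = ⇔-→ A⇔B (mk⇔ id id)

⊨-iso : ∀ G H (f : V G ↔ V H) →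
  (∀ u v → Graph._~_ G u v ⇔ Graph._~_ H (Inverse.to f u) (Inverse.to f v)) →
  (φ : Formula p) (ρ : Vec (V G) p) (σ : Vec (V H) p) →
  (∀ i → Inverse.to f (lookup ρ i) ≡ lookup σ i) →
  (G ⊨ φ [ ρ ]) ⇔ (H ⊨ φ [ σ ])
⊨-iso {p} G H f adjacency = go
  where
  module f = Inverse f
  go : ∀ {p} (φ : Formula p) ρ σ → (∀ i → f.to (lookup ρ i) ≡ lookup σ i) →
       (G ⊨ φ [ ρ ]) ⇔ (H ⊨ φ [ σ ])
  go (i ≐ j) ρ σ eq = ⇔-¬ (⇔-¬ (mk⇔
    (λ e → trans (sym (eq i)) (trans (cong f.to e) (eq j)))
    (λ e → trans (sym (f.strictlyInverseʳ _)) (trans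
      (cong f.from (trans (eq i) (trans e (sym (eq j))))) (f.strictlyInverseʳ _)))))
  go (i ∼ j) ρ σ eq = ⇔-¬ (⇔-¬ (subst₂ (λ x y → _ ⇔ Graph._~_ H x y) (eq i) (eq j)
    (adjacency (lookup ρ i) (lookup ρ j))))
  go false   ρ σ eq = mk⇔ id id
  go (φ ⊃ ψ) ρ σ eq = ⇔-→ (go φ ρ σ eq) (go ψ ρ σ eq)
  go (all φ) ρ σ eq = mk⇔
    (λ s w → go φ (f.from w ∷ ρ) (w ∷ σ) (λ { zero → f.strictlyInverseˡ w ; (suc i) → eq i })
               .to (s (f.from w)))
    (λ s v → go φ (v ∷ ρ) (f.to v ∷ σ) (λ { zero → refl ; (suc i) → eq i }) .from (s (f.to v)))

-- Derived connectives and quantifiers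

infixr 5.5 _⋏_

~_ : Formula p → Formula p
~ φ = φ ⊃ false

_⋏_ : Formula p → Formula p → Formula p
φ ⋏ ψ = ~ (φ ⊃ ~ ψ)

ex : Formula (suc p) → Formula p
ex φ = ~ all (~ φ)

⋀ : ∀ {m} → (Fin m → Formula p) → Formula p
⋀ {m = zero}  φ = ~ false
⋀ {m = suc m} φ = φ zero ⋏ ⋀ (φ ∘ suc)

⊨-⋏ : ∀ G (φ ψ : Formula p) ρ → (G ⊨ φ ⋏ ψ [ ρ ]) ⇔ ((G ⊨ φ [ ρ ]) × (G ⊨ ψ [ ρ ]))
⊨-⋏ G φ ψ ρ = mk⇔
  (λ s → ⊨-stable G φ ρ (λ ¬t → s λ t _ → ¬t t) , ⊨-stable G ψ ρ (λ ¬u → s λ _ u → ¬u u))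
  (λ (t , u) f → f t u)

⊨-⋀ : ∀ G {m} (φ : Fin m → Formula p) ρ → (G ⊨ ⋀ φ [ ρ ]) ⇔ (∀ i → G ⊨ φ i [ ρ ])
⊨-⋀ G {m = zero}  φ ρ = mk⇔ (λ _ ()) (λ _ ())
⊨-⋀ G {m = suc m} φ ρ = mk⇔
  (λ s → let (t , u) = ⊨-⋏ G (φ zero) (⋀ (φ ∘ suc)) ρ .to s in
    λ { zero → t ; (suc i) → ⊨-⋀ G (φ ∘ suc) ρ .to u i })
  (λ s → ⊨-⋏ G (φ zero) (⋀ (φ ∘ suc)) ρ .from (s zero , ⊨-⋀ G (φ ∘ suc) ρ .from (s ∘ suc)))

-- The quantifier is classical and hides its witness under a double negation; later goals are
-- decidable or ¬¬-stable, so the witness can still be used there.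
⊨-ex : ∀ G (φ : Formula (suc p)) ρ → (G ⊨ ex φ [ ρ ]) ⇔ (¬ ¬ ∃ λ v → G ⊨ φ [ v ∷ ρ ])
⊨-ex G φ ρ = mk⇔ (λ s ¬∃ → s λ v t → ¬∃ (v , t)) (λ ¬¬∃ f → ¬¬∃ λ (v , t) → f v t)

exs : ∀ m → Formula (m + p) → Formula p
exs zero    φ = φ
exs (suc m) φ = exs m (ex φ)

⊨-exs : ∀ G m (φ : Formula (m + p)) ρ →
        (G ⊨ exs m φ [ ρ ]) ⇔ (¬ ¬ ∃ λ vs → G ⊨ φ [ vs ++ ρ ])
⊨-exs G zero    φ ρ = mk⇔ (λ s ¬∃ → ¬∃ ([] , s)) (λ ¬¬∃ → ⊨-stable G φ ρ λ ¬s → ¬¬∃ λ { ([] , s) → ¬s s })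
⊨-exs G (suc m) φ ρ = mk⇔
  (λ s ¬∃ → ⊨-exs G m (ex φ) ρ .to s λ (vs , t) → ⊨-ex G φ (vs ++ ρ) .to t λ (v , u) → ¬∃ (v ∷ vs , u))
  (λ ¬¬∃ → ⊨-exs G m (ex φ) ρ .from λ ¬∃ → ¬¬∃ λ { (v ∷ vs , s) →
    ¬∃ (vs , ⊨-ex G φ (vs ++ ρ) .from λ k → k (v , s)) })

-- Relativisation to a ball

-- "Equal, or adjacent to a vertex from which k steps suffice", with the disjunction written as an
-- implication from a negation.
reach : ℕ → Fin p → Fin p → Formula p
reach zero    x y = x ≐ y
reach (suc k) x y = ~ (x ≐ y) ⊃ ex (suc x ∼ zero ⋏ reach k zero (suc y))

⊨-reach : ∀ G k (x y : Fin p) ρ →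
          (G ⊨ reach k x y [ ρ ]) ⇔ (¬ ¬ Dist≤ G k (lookup ρ x) (lookup ρ y))
⊨-reach G zero    x y ρ = mk⇔
  (λ s ¬d → s λ eq → ¬d (0 , z≤n , eq))
  (λ ¬¬d ¬eq → ¬¬d λ { (zero , _ , eq) → ¬eq eq })
⊨-reach {p} G (suc k) x y ρ = mk⇔
  (λ s ¬d → s
    (λ ¬¬eq → ¬¬eq λ eq → ¬d (0 , z≤n , eq))
    λ v t → let (e , u) = ⊨-⋏ G (suc x ∼ zero) (reach k zero (suc y)) (v ∷ ρ) .to t in
      e λ x~v → ⊨-reach G k zero (suc y) (v ∷ ρ) .to u λ d → ¬d (dist-cons G x~v d))
  (λ ¬¬d ¬eq → ⊨-ex G (suc x ∼ zero ⋏ reach k zero (suc y)) ρ .from λ ¬∃ → ¬¬d λ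
    { (zero  , _ , eq) → ¬eq λ k → k eq
    ; (suc j , s≤s j≤k , v , x~v , vy) → ¬∃ (v ,
        ⊨-⋏ G (suc x ∼ zero) (reach k zero (suc y)) (v ∷ ρ) .from
          ( (λ k → k x~v)
          , ⊨-reach G k zero (suc y) (v ∷ ρ) .from λ ¬d → ¬d (j , j≤k , vy))) })

relativise : ℕ → Fin p → Formula p → Formula p
relativise r x (i ≐ j) = i ≐ j
relativise r x (i ∼ j) = i ∼ j
relativise r x false   = false
relativise r x (φ ⊃ ψ) = relativise r x φ ⊃ relativise r x ψ
relativise r x (all φ) = all (reach r (suc x) zero ⊃ relativise r (suc x) φ)

module _ (G : Graph) (r : ℕ) (v : V G) where

  private
    W = N G r (v ∷ [])
    H = induced G W

  ⊨-relativise : (φ : Formula p) (x : Fin p) (ρ : Vec (V H) p) (σ : Vec (V G) p) →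
    (∀ i → value (lookup ρ i) ≡ lookup σ i) → lookup σ x ≡ v →
    (G ⊨ relativise r x φ [ σ ]) ⇔ (H ⊨ φ [ ρ ])
  ⊨-relativise (i ≐ j) x ρ σ eq root = ⇔-¬ (⇔-¬ (mk⇔
    (λ e → value-injective (trans (eq i) (trans e (sym (eq j)))))
    (λ e → trans (sym (eq i)) (trans (cong value e) (eq j)))))
  ⊨-relativise (i ∼ j) x ρ σ eq root = ⇔-¬ (⇔-¬ (subst₂
    (λ a b → Graph._~_ G a b ⇔ Graph._~_ H (lookup ρ i) (lookup ρ j)) (eq i) (eq j) (mk⇔ id id)))
  ⊨-relativise false   x ρ σ eq root = mk⇔ id id
  ⊨-relativise (φ ⊃ ψ) x ρ σ eq root = ⇔-→ (⊨-relativise φ x ρ σ eq root) (⊨-relativise ψ x ρ σ eq root)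
  ⊨-relativise (all φ) x ρ σ eq root = mk⇔
    (λ { s a@(w , [ near ]) → ⊨-relativise φ (suc x) (a ∷ ρ) (w ∷ σ)
          (λ { zero → refl ; (suc i) → eq i }) root .to
          (s w (⊨-reach G r (suc x) zero (w ∷ σ) .from λ ¬d →
            -- `near` is irrelevant, and in an arbitrary graph there is no decision procedure to
            -- recover it. The guard only asserts a doubly negated distance, so what remains to be
            -- derived is a contradiction, where irrelevant evidence may be used.
            ⊥-elim-irr (¬d (subst (λ u → Dist≤ G r u w) (sym root) (root-dist near))))) })
    (λ s w t → ⊨-stable G (relativise r (suc x) φ) (w ∷ σ) λ ¬u →
      ⊨-reach G r (suc x) zero (w ∷ σ) .to t λ d →
      let a = w , [ (zero , subst (λ u → Dist≤ G r u w) root d) ] in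
      ¬u (⊨-relativise φ (suc x) (a ∷ ρ) (w ∷ σ) (λ { zero → refl ; (suc i) → eq i }) root
            .from (s a)))
    where
    root-dist : ∀ {w} → W w → Dist≤ G r v w
    root-dist (zero , d) = d

⊨-relativise-full : ∀ G r (φ : Formula p) (x : Fin p) ρ →
  (∀ w → ¬ ¬ Dist≤ G r (lookup ρ x) w) →
  (G ⊨ relativise r x φ [ ρ ]) ⇔ (G ⊨ φ [ ρ ])
⊨-relativise-full G r (i ≐ j) x ρ near = mk⇔ id id
⊨-relativise-full G r (i ∼ j) x ρ near = mk⇔ id id
⊨-relativise-full G r false   x ρ near = mk⇔ id id
⊨-relativise-full G r (φ ⊃ ψ) x ρ near =
  ⇔-→ (⊨-relativise-full G r φ x ρ near) (⊨-relativise-full G r ψ x ρ near)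
⊨-relativise-full G r (all φ) x ρ near = mk⇔
  (λ s w → ⊨-relativise-full G r φ (suc x) (w ∷ ρ) near .to
    (s w (⊨-reach G r (suc x) zero (w ∷ ρ) .from (near w))))
  (λ s w _ → ⊨-relativise-full G r φ (suc x) (w ∷ ρ) near .from (s w))

-- Both sides are equivalent to the truth of `φ` itself in the ball: in `G` because the guards cut
-- the quantifiers down to the ball, and in the ball because shortest walks from the centre stay
-- inside it, so that every guard holds.
relativise-local : ∀ r (φ : Formula 1) → IsLocal r (relativise r zero φ)
relativise-local r φ G (v ∷ []) =
  mk⇔ (full .from ∘ restrict .to) (restrict .from ∘ full .to)
  where
  H = induced G (N G r (v ∷ []))
  restrict = ⊨-relativise G r v φ zero (centres G r (v ∷ [])) (v ∷ []) (λ { zero → refl }) refl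
  near : ∀ w → ¬ ¬ Dist≤ H r (lookup (centres G r (v ∷ [])) zero) w
  near (w , [ near ]) ¬d = ⊥-elim-irr (¬d (lift near))
    where
    lift : (c : N G r (v ∷ []) w) → Dist≤ H r (lookup (centres G r (v ∷ [])) zero) (w , [ c ])
    lift (zero , d) = dist-induced G (N G r (v ∷ [])) r (λ u d → zero , d) d
  full = ⊨-relativise-full H r φ zero (centres G r (v ∷ [])) near

-- Defining the isomorphism type of a rooted graph

literal : Bool → Formula p → Formula p
literal b φ = if b then φ else ~ φ

⊨-literal : ∀ H b (φ : Formula p) ρ {t} → (H ⊨ φ [ ρ ]) ⇔ (¬ ¬ T t) →
            (H ⊨ literal b φ [ ρ ]) ⇔ (t ≡ b)
⊨-literal H true  φ ρ {true}  e = mk⇔ (λ _ → refl) (λ _ → e .from λ ¬t → ¬t _)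
⊨-literal H true  φ ρ {false} e = mk⇔ (λ s → ⊥-elim (e .to s λ ())) (λ ())
⊨-literal H false φ ρ {true}  e = mk⇔ (λ s → ⊥-elim (s (e .from λ ¬t → ¬t _))) (λ ())
⊨-literal H false φ ρ {false} e = mk⇔ (λ _ → refl) (λ _ s → e .to s λ ())

module BallFormula (F : FinGraph) (o : Fin (order F)) where

  private
    m = order F

    vertex : Fin m → Fin (m + 1)
    vertex i = i ↑ˡ 1

    root : Fin (m + 1)
    root = m ↑ʳ zero

    distinct : Fin m → Fin m → Formula (m + 1)
    distinct i j with i Fin.≟ j
    ... | yes _ = ~ false
    ... | no  _ = ~ (vertex i ≐ vertex j)

    edge : Fin m → Fin m → Formula (m + 1)
    edge i j = literal (adj F i j) (vertex i ∼ vertex j)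

    -- The disjunction over `i` in De Morgan form.
    exhaustive : Formula (m + 1)
    exhaustive = all (~ ⋀ λ i → ~ (zero ≐ suc (vertex i)))

    -- The clauses of `Listing` apart from membership in the ball, which is automatic because the
    -- formula is evaluated inside the ball.
    distincts edges listing : Formula (m + 1)
    distincts = ⋀ λ i → ⋀ (distinct i)
    edges     = ⋀ λ i → ⋀ (edge i)
    listing   = exhaustive ⋏ distincts ⋏ edges ⋏ vertex o ≐ root

  isomorphic : Formula 1
  isomorphic = exs m listing

  module _ (G : FinGraph) (r : ℕ) (v : Fin (order G)) where

    open BallIso G r v F o

    private
      g = graph G
      W = N g r (v ∷ [])
      H = induced g W
      c = centres g r (v ∷ [])

      W⇒D : ∀ {w} → W w → Dist≤ g r v w
      W⇒D (zero , d) = d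

      module _ (es : Vec (V H) m) where

        lookup-vertex : ∀ i → lookup (es ++ c) (vertex i) ≡ lookup es i
        lookup-vertex i = lookup-++ˡ es c i

        lookup-root : lookup (es ++ c) root ≡ lookup c zero
        lookup-root = lookup-++ʳ es c zero

        vals : Vec (Fin (order G)) m
        vals = Vec.map value es

        lookup-vals : ∀ i → lookup vals i ≡ value (lookup es i)
        lookup-vals i = lookup-map i value es

        val≡ : ∀ i → value (lookup (es ++ c) (vertex i)) ≡ lookup vals i
        val≡ i = trans (cong value (lookup-vertex i)) (sym (lookup-vals i))

        ⊨-distinct : (H ⊨ distincts [ es ++ c ]) ⇔
                     (∀ i j → lookup vals i ≡ lookup vals j → i ≡ j)
        ⊨-distinct = mk⇔
          (λ s i j → to′ i j (⊨-⋀ H (distinct i) (es ++ c) .to (⊨-⋀ H (λ i → ⋀ (distinct i)) (es ++ c) .to s i) j))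
          (λ inj → ⊨-⋀ H (λ i → ⋀ (distinct i)) (es ++ c) .from λ i →
            ⊨-⋀ H (distinct i) (es ++ c) .from λ j → from′ i j (inj i j))
          where
          to′ : ∀ i j → H ⊨ distinct i j [ es ++ c ] → lookup vals i ≡ lookup vals j → i ≡ j
          to′ i j s eq with i Fin.≟ j
          ... | yes i≡j = i≡j
          ... | no  _   = ⊥-elim (s λ ¬e → ¬e (value-injective (trans (val≡ i) (trans eq (sym (val≡ j))))))
          from′ : ∀ i j → (lookup vals i ≡ lookup vals j → i ≡ j) → H ⊨ distinct i j [ es ++ c ]
          from′ i j inj with i Fin.≟ j
          ... | yes _   = λ z → z
          ... | no  i≢j = λ ¬¬e → ¬¬e λ e → i≢j (inj (trans (sym (val≡ i)) (trans (cong value e) (val≡ j))))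

        ⊨-edges : (H ⊨ edges [ es ++ c ]) ⇔
                  (∀ i j → adj G (lookup vals i) (lookup vals j) ≡ adj F i j)
        ⊨-edges = mk⇔
          (λ s i j → to′ i j (⊨-⋀ H (edge i) (es ++ c) .to (⊨-⋀ H (λ i → ⋀ (edge i)) (es ++ c) .to s i) j))
          (λ eq → ⊨-⋀ H (λ i → ⋀ (edge i)) (es ++ c) .from λ i →
            ⊨-⋀ H (edge i) (es ++ c) .from λ j → from′ i j (eq i j))
          where
          adj≡ : ∀ i j → adj G (value (lookup (es ++ c) (vertex i))) (value (lookup (es ++ c) (vertex j)))
                         ≡ adj G (lookup vals i) (lookup vals j)
          adj≡ i j = cong₂ (adj G) (val≡ i) (val≡ j)
          to′ : ∀ i j → H ⊨ edge i j [ es ++ c ] → adj G (lookup vals i) (lookup vals j) ≡ adj F i j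
          to′ i j s = trans (sym (adj≡ i j))
            (⊨-literal H (adj F i j) (vertex i ∼ vertex j) (es ++ c) (mk⇔ id id) .to s)
          from′ : ∀ i j → adj G (lookup vals i) (lookup vals j) ≡ adj F i j → H ⊨ edge i j [ es ++ c ]
          from′ i j eq = ⊨-literal H (adj F i j) (vertex i ∼ vertex j) (es ++ c)
            (mk⇔ id id) .from (trans (adj≡ i j) eq)

        ⊨-exhaustive : (H ⊨ exhaustive [ es ++ c ]) ⇔
                       (∀ w → Dist≤ g r v w → ∃ λ i → lookup vals i ≡ w)
        ⊨-exhaustive = mk⇔
          (λ s w d → decidable-stable (Fin.any? λ i → lookup vals i Fin.≟ w) λ ¬∃ →
            let a = w , [ (zero , d) ] in
            s a (⊨-⋀ H (λ i → ~ (zero ≐ suc (vertex i))) (a ∷ es ++ c) .from λ i ¬¬e →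
              ¬¬e λ e → ¬∃ (i , trans (sym (val≡ i)) (sym (cong value e)))))
          (λ onto → λ { a@(w , [ near ]) s →
            let (i , e) = onto w (recompute (dist≤? G r v w) (W⇒D near)) in
            ⊨-⋀ H (λ i → ~ (zero ≐ suc (vertex i))) (a ∷ es ++ c) .to s i λ ¬e →
              ¬e (value-injective (trans (sym e) (sym (val≡ i)))) })

        ⊨-root : (H ⊨ vertex o ≐ root [ es ++ c ]) ⇔ (lookup vals o ≡ v)
        ⊨-root = mk⇔
          (λ s → decidable-stable (lookup vals o Fin.≟ v) λ ¬e → s λ e →
            ¬e (trans (sym (val≡ o)) (trans (cong value e) (cong value lookup-root))))
          (λ e ¬e → ¬e (trans (value-injective (trans (val≡ o) e)) (sym lookup-root)))

        ⊨-listing : (H ⊨ listing [ es ++ c ]) ⇔ Listing vals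
        ⊨-listing = mk⇔
          (λ s → let (a , t) = ⊨-⋏ H exhaustive (distincts ⋏ edges ⋏ vertex o ≐ root) (es ++ c) .to s
                     (b , u) = ⊨-⋏ H distincts (edges ⋏ vertex o ≐ root) (es ++ c) .to t
                     (d , e) = ⊨-⋏ H edges (vertex o ≐ root) (es ++ c) .to u
                 in within , ⊨-exhaustive .to a , ⊨-distinct .to b , ⊨-edges .to d , ⊨-root .to e)
          (λ (_ , a , b , d , e) →
            ⊨-⋏ H exhaustive (distincts ⋏ edges ⋏ vertex o ≐ root) (es ++ c) .from (⊨-exhaustive .from a ,
            ⊨-⋏ H distincts (edges ⋏ vertex o ≐ root) (es ++ c) .from (⊨-distinct .from b ,
            ⊨-⋏ H edges (vertex o ≐ root) (es ++ c) .from (⊨-edges .from d ,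
            ⊨-root .from e))))
          where
          within : ∀ i → Dist≤ g r v (lookup vals i)
          within i = subst (Dist≤ g r v) (sym (lookup-vals i)) (inside (lookup es i))
            where
            inside : (a : V H) → Dist≤ g r v (value a)
            inside (w , [ near ]) = recompute (dist≤? G r v w) (W⇒D near)

    -- `H` is cut out by `N` and `ball` by `Dist≤`, so they are different types. Listings consist of
    -- vertices of `G` and make sense for both, which avoids transporting isomorphisms between the
    -- two subgraphs.
    ⊨-isomorphic : (H ⊨ isomorphic [ c ]) ⇔ Iso
    ⊨-isomorphic = mk⇔
      (λ s → decidable-stable iso? λ ¬iso → ⊨-exs H m listing c .to s λ (es , t) →
        ¬iso (listing⇒iso (vals es , ⊨-listing es .to t)))
      (λ iso → ⊨-exs H m listing c .from λ ¬∃ →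
        let (e , l@(inD , _)) = iso⇒listing iso
            f = λ i → lookup e i , [ (zero , inD i) ]
        in ¬∃ (tabulate f , ⊨-listing (tabulate f) .from
             (subst Listing (trans (sym (tabulate∘lookup e)) (tabulate-∘ value f)) l)))

  ballFormula : ℕ → Formula 1
  ballFormula r = relativise r zero isomorphic

  ballFormula-frequency : ∀ r G → ⟨ ballFormula r , G ⟩ ≡ ballFrequency r F o G
  ballFormula-frequency r G = cong₂ ratio count (ℕ.*-identityʳ (order G))
    where
    open ≡-Reasoning
    φ = ballFormula r
    count : length (filter (sat? G φ) (tuples (order G) 1))
            ≡ length (filter (λ v → BallIso.iso? G r v F o) (allFin (order G)))
    count = begin
      length (filter (sat? G φ) (tuples (order G) 1))
        ≡⟨ length-filter-∑ (sat? G φ) (tuples (order G) 1) ⟩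
      ∑ (tuples (order G) 1) (λ vs → ⟦ sat? G φ vs ⟧)
        ≡⟨ ∑-cartesianProductWith _∷_ (allFin (order G)) (tuples (order G) 0) _ ⟩
      ∑ (allFin (order G)) (λ v → ⟦ sat? G φ (v ∷ []) ⟧ + 0)
        ≡⟨ ∑-cong (allFin (order G)) (λ v → trans (ℕ.+-identityʳ _)
             (⟦⟧-cong (sat? G φ (v ∷ [])) (BallIso.iso? G r v F o) (equiv v))) ⟩
      ∑ (allFin (order G)) (λ v → ⟦ BallIso.iso? G r v F o ⟧)
        ≡⟨ length-filter-∑ (λ v → BallIso.iso? G r v F o) (allFin (order G)) ⟨
      length (filter (λ v → BallIso.iso? G r v F o) (allFin (order G))) ∎
      where
      equiv : ∀ v → (graph G ⊨ φ [ v ∷ [] ]) ⇔ BallIso.Iso G r v F o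
      equiv v = mk⇔ (⊨-isomorphic G r v .to ∘ restrict .to) (restrict .from ∘ ⊨-isomorphic G r v .from)
        where
        restrict = ⊨-relativise (graph G) r v isomorphic zero (centres (graph G) r (v ∷ [])) (v ∷ [])
          (λ { zero → refl }) refl

FO-local₁⇒BS : ∀ d G → Convergent FO-local₁ G → BSConvergent d G
FO-local₁⇒BS d G conv r F o _ _ = Cauchy⇒Converges {λ n → ballFrequency r F o (G n)}
  (Cauchy-cong {λ n → ⟨ ballFormula r , G n ⟩} {λ n → ballFrequency r F o (G n)}
    (λ n → ballFormula-frequency r (G n))
    (Converges⇒Cauchy {λ n → ⟨ ballFormula r , G n ⟩}
      (conv (ballFormula r) (refl , r , relativise-local r isomorphic))))
  where open BallFormula F o

FO-local⇒FO-local₁ : ∀ G → Convergent FO-local G → Convergent FO-local₁ G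
FO-local⇒FO-local₁ G conv φ (_ , local) = conv φ local

-- Rooted isomorphisms

rootedIso-sym : ∀ {G a H b} → RootedIso G a H b → RootedIso H b G a
rootedIso-sym {G} {a} {H} {b} I = record
  { vertices  = ↔-sym I.vertices
  ; adjacency = λ u v → mk⇔
      (λ e → I.adjacency (I.from u) (I.from v) .from
        (subst₂ (Graph._~_ H) (sym (strictlyInverseˡ u)) (sym (strictlyInverseˡ v)) e))
      (λ e → subst₂ (Graph._~_ H) (strictlyInverseˡ u) (strictlyInverseˡ v)
        (I.adjacency (I.from u) (I.from v) .to e))
  ; root      = trans (cong I.from (sym I.root)) (strictlyInverseʳ a)
  }
  where
  module I = RootedIso I
  open Inverse I.vertices using (strictlyInverseˡ; strictlyInverseʳ)

rootedIso-trans : ∀ {G a H b K c} → RootedIso G a H b → RootedIso H b K c → RootedIso G a K c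
rootedIso-trans I J = record
  { vertices  = J.vertices ↔-∘ I.vertices
  ; adjacency = λ u v → mk⇔
      (J.adjacency _ _ .to ∘ I.adjacency u v .to)
      (I.adjacency u v .from ∘ J.adjacency _ _ .from)
  ; root      = trans (cong J.to I.root) J.root
  }
  where
  module I = RootedIso I
  module J = RootedIso J

walk-map : ∀ G H (f : V G → V H) → (∀ {u v} → Graph._~_ G u v → Graph._~_ H (f u) (f v)) →
           ∀ k {u v} → Walk G k u v → Walk H k (f u) (f v)
walk-map G H f hom zero    refl = refl
walk-map G H f hom (suc k) (w , u~w , wv) = f w , hom u~w , walk-map G H f hom k wv

-- Rooted graphs that occur as balls

RootedGraph : Set
RootedGraph = ∃ λ F → Fin (order F)

Ball≅ : ℕ → (G : FinGraph) → Fin (order G) → RootedGraph → Set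
Ball≅ r G v (F , o) = BallIso.Iso G r v F o

ball≅? : ∀ r G v X → Dec (Ball≅ r G v X)
ball≅? r G v (F , o) = BallIso.iso? G r v F o

-- A decidable condition met by every ball in question. It makes a rooted graph connected, so that
-- BS-convergence applies to it, and equal to its own r-ball, so that isomorphism with it can be
-- tested by `ball≅?`.
Good : ℕ → ℕ → RootedGraph → Set
Good d r (F , o) = MaxDegree≤ d F × (∀ i → Dist≤ (graph F) r o i)

good? : ∀ d r X → Dec (Good d r X)
good? d r (F , o) = Fin.all? (λ i → degree F i ℕ.≤? d) ×-dec Fin.all? (dist≤? F r o)

good-connected : ∀ {d r} ((F , o) : RootedGraph) → Good d r (F , o) → Connected (graph F)
good-connected {r = r} (F , o) (_ , radius) u v =
  let (k , _ , w) = dist-trans (graph F) (dist-sym (graph F) (radius u)) (radius v) in k , w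

good-ball : ∀ {d r} ((F , o) : RootedGraph) → Good d r (F , o) → Ball≅ r F o (F , o)
good-ball {d} {r} (F , o) (_ , radius) = record
  { vertices  = mk↔ₛ′ value (λ i → i , [ radius i ]) (λ _ → refl) (λ _ → refl)
  ; adjacency = λ _ _ → mk⇔ id id
  ; root      = refl
  }

-- Regrouped by the value of `f`, each fibre contains at most one index.
∑-injective : ∀ {m n} (f : Fin m → Fin n) → (∀ i j → f i ≡ f j → i ≡ j) → (g : Fin n → ℕ) →
              ∑ (allFin m) (g ∘ f) ≤ ∑ (allFin n) g
∑-injective {m} {n} f inj g = begin
  ∑ (allFin m) (g ∘ f)
    ≡⟨ ∑-cong (allFin m) (λ i → ∑-allFin-≡ (f i) g) ⟨
  ∑ (allFin m) (λ i → ∑ (allFin n) (λ j → ⟦ f i Fin.≟ j ⟧ * g j))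
    ≡⟨ ∑-swap (allFin m) (allFin n) _ ⟩
  ∑ (allFin n) (λ j → ∑ (allFin m) (λ i → ⟦ f i Fin.≟ j ⟧ * g j))
    ≡⟨ ∑-cong (allFin n) (λ j → ∑-*ʳ (allFin m) (g j) _) ⟩
  ∑ (allFin n) (λ j → ∑ (allFin m) (λ i → ⟦ f i Fin.≟ j ⟧) * g j)
    ≤⟨ ∑-mono (allFin n) (λ j → ℕ.*-monoˡ-≤ (g j) (fibre j)) ⟩
  ∑ (allFin n) (λ j → 1 * g j)
    ≡⟨ ∑-cong (allFin n) (λ j → ℕ.*-identityˡ (g j)) ⟩
  ∑ (allFin n) g ∎
  where
  open ℕ.≤-Reasoning
  fibre : ∀ j → ∑ (allFin m) (λ i → ⟦ f i Fin.≟ j ⟧) ≤ 1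
  fibre j with Fin.any? (λ i → f i Fin.≟ j)
  ... | yes (k , fk≡j) = ℕ.≤-trans
    (∑-mono (allFin m) {g = λ i → ⟦ k Fin.≟ i ⟧ * 1} λ i → ℕ.≤-trans
      (⟦⟧-mono (f i Fin.≟ j) (k Fin.≟ i) λ fi≡j → inj k i (trans fk≡j (sym fi≡j)))
      (ℕ.≤-reflexive (sym (ℕ.*-identityʳ ⟦ k Fin.≟ i ⟧))))
    (ℕ.≤-reflexive (∑-allFin-≡ k (λ _ → 1)))
  ... | no ¬∃ = ℕ.≤-trans
    (ℕ.≤-reflexive (trans (∑-cong (allFin m) {g = λ _ → 0} λ i → ⟦⟧-false (f i Fin.≟ j) λ e → ¬∃ (i , e))
      (trans (∑-const (allFin m) 0) (ℕ.*-zeroʳ (length (allFin m)))))) z≤n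

-- The listing embeds the neighbours of a vertex of `F` into the neighbours of its image in `G`. For
-- the radius, walks from the centre remain in the ball and are carried to `F` by the isomorphism.
ball-good : ∀ {d r} G → MaxDegree≤ d G → ∀ v (X : RootedGraph) → Ball≅ r G v X → Good d r X
ball-good {d} {r} G deg v (F , o) I = maxDegree , radius
  where
  module I = RootedIso I
  maxDegree : MaxDegree≤ d F
  maxDegree i with BallIso.iso⇒listing G r v F o I
  ... | e , _ , _ , inj , edges , _ = begin
    degree F i
      ≡⟨ length-filter-∑ (λ j → T? (adj F i j)) (allFin (order F)) ⟩
    ∑ (allFin (order F)) (λ j → ⟦ T? (adj F i j) ⟧)
      ≡⟨ ∑-cong (allFin (order F)) (λ j → cong (λ b → ⟦ T? b ⟧) (sym (edges i j))) ⟩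
    ∑ (allFin (order F)) (λ j → ⟦ T? (adj G (lookup e i) (lookup e j)) ⟧)
      ≤⟨ ∑-injective (lookup e) inj (λ w → ⟦ T? (adj G (lookup e i) w) ⟧) ⟩
    ∑ (allFin (order G)) (λ w → ⟦ T? (adj G (lookup e i) w) ⟧)
      ≡⟨ length-filter-∑ (λ w → T? (adj G (lookup e i) w)) (allFin (order G)) ⟨
    degree G (lookup e i)
      ≤⟨ deg (lookup e i) ⟩
    d ∎
    where open ℕ.≤-Reasoning

  radius : ∀ i → Dist≤ (graph F) r o i
  radius i = subst₂ (Dist≤ (graph F) r) I.root (Inverse.strictlyInverseˡ I.vertices i)
    (from-centre (I.from i))
    where
    g = graph G
    from-centre : (x : V (ball g r v)) → Dist≤ (graph F) r (I.to (centre g r v)) (I.to x)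
    from-centre (w , [ near ]) =
      let (k , k≤r , cw) = dist-induced g (Dist≤ g r v) r (λ _ d → d) (recompute (dist≤? G r v w) near)
      in k , k≤r , walk-map (ball g r v) (graph F) I.to (λ {x} {y} → I.adjacency x y .to) k cw

-- Enumeration of rooted graphs

-- Bits live in `Fin 2` so that `tuples 2` enumerates all bit vectors, with completeness given by
-- `∈-tuples`.
bit : Bool → Fin 2
bit = Inverse.from Fin.2↔Bool

unbit : Fin 2 → Bool
unbit = Inverse.to Fin.2↔Bool

≡ᵇ-sym : ∀ {m} (i j : Fin m) → does (i Fin.≟ j) ≡ does (j Fin.≟ i)
≡ᵇ-sym i j with i Fin.≟ j | j Fin.≟ i
... | yes _   | yes _   = refl
... | no  _   | no  _   = refl
... | yes i≡j | no  j≢i = contradiction (sym i≡j) j≢i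
... | no  i≢j | yes j≡i = contradiction (sym j≡i) i≢j

-- The bits are the entries of an m × m matrix, symmetrised to make every bit
-- vector an adjacency matrix.
fromBits : ∀ m → Vec (Fin 2) (m * m) → FinGraph
fromBits m bits = record
  { order      = m
  ; adj        = λ i j → (entry i j ∨ entry j i) ∧ not (does (i Fin.≟ j))
  ; adj-sym    = λ i j → cong₂ _∧_ (Bool.∨-comm (entry i j) (entry j i)) (cong not (≡ᵇ-sym i j))
  ; adj-irrefl = irrefl
  }
  where
  entry : Fin m → Fin m → Bool
  entry i j = unbit (lookup bits (combine i j))
  irrefl : ∀ i → (entry i i ∨ entry i i) ∧ not (does (i Fin.≟ i)) ≡ false
  irrefl i with i Fin.≟ i
  ... | yes _  = Bool.∧-zeroʳ (entry i i ∨ entry i i)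
  ... | no i≢i = contradiction refl i≢i

toBits : ∀ m → (Fin m → Fin m → Bool) → Vec (Fin 2) (m * m)
toBits m A = tabulate (bit ∘ uncurry A ∘ remQuot m)

fromBits-toBits : ∀ m (A : Fin m → Fin m → Bool) → (∀ i j → A i j ≡ A j i) → (∀ i → A i i ≡ false) →
                  ∀ i j → adj (fromBits m (toBits m A)) i j ≡ A i j
fromBits-toBits m A A-sym A-irrefl i j = trans
  (cong (_∧ not (does (i Fin.≟ j)))
    (trans (cong₂ _∨_ (entry≡ i j) (trans (entry≡ j i) (A-sym j i))) (Bool.∨-idem (A i j))))
  off-diagonal
  where
  entry≡ : ∀ i j → unbit (lookup (toBits m A) (combine i j)) ≡ A i j
  entry≡ i j = begin
    unbit (lookup (toBits m A) (combine i j))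
      ≡⟨ cong unbit (lookup∘tabulate (bit ∘ uncurry A ∘ remQuot m) (combine i j)) ⟩
    unbit (bit (uncurry A (remQuot m (combine i j))))
      ≡⟨ Inverse.strictlyInverseˡ Fin.2↔Bool _ ⟩
    uncurry A (remQuot m (combine i j))
      ≡⟨ cong (uncurry A) (Fin.remQuot-combine i j) ⟩
    A i j ∎
    where open ≡-Reasoning
  off-diagonal : A i j ∧ not (does (i Fin.≟ j)) ≡ A i j
  off-diagonal with i Fin.≟ j
  ... | no  _    = Bool.∧-identityʳ (A i j)
  ... | yes refl rewrite A-irrefl i = refl

-- These are labelled graphs, and isomorphic ones are not merged; the repetitions are dealt with by
-- the choice of least indices in `Types`.
rootedGraphs : ℕ → List RootedGraph
rootedGraphs M = concatMap
  (λ m → concatMap (λ bits → List.map (fromBits m bits ,_) (allFin m)) (tuples 2 (m * m)))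
  (upTo (suc M))

∈-rootedGraphs : ∀ {M m} → m ≤ M → (bits : Vec (Fin 2) (m * m)) (o : Fin m) →
                 (fromBits m bits , o) ∈ rootedGraphs M
∈-rootedGraphs {M} {m} m≤M bits o =
  ∈-concatMap⁺ (λ m → concatMap (λ bits → List.map (fromBits m bits ,_) (allFin m)) (tuples 2 (m * m)))
    (lose (∈-upTo⁺ (s≤s m≤M))
      (∈-concatMap⁺ (λ bits → List.map (fromBits m bits ,_) (allFin m))
        (lose (∈-tuples bits) (∈-map⁺ (fromBits m bits ,_) (∈-allFin o)))))

lookup-injective : ∀ {a} {A : Set a} {xs : List A} → Unique xs →
                   ∀ i j → List.lookup xs i ≡ List.lookup xs j → i ≡ j
lookup-injective (x∉ ∷ u) zero    zero    eq = refl
lookup-injective (x∉ ∷ u) (suc i) (suc j) eq = cong suc (lookup-injective u i j eq)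
lookup-injective (x∉ ∷ u) zero    (suc j) eq = contradiction eq (All.lookup x∉ (∈-lookup j))
lookup-injective (x∉ ∷ u) (suc i) zero    eq = contradiction (sym eq) (All.lookup x∉ (∈-lookup i))

-- The vertices of the ball are labelled by their positions in the filtered list `ws`; since `ws`
-- has no repetitions, the labelling is a listing.
ball∈rootedGraphs : ∀ {d} r G → MaxDegree≤ d G → ∀ v →
                    ∃ λ X → X ∈ rootedGraphs (ballBound d r) × Ball≅ r G v X
ball∈rootedGraphs {d} r G deg v =
  (F , o) , ∈-rootedGraphs m≤M bits o , BallIso.listing⇒iso G r v F o
    ( e
    , (λ i → subst (Dist≤ (graph G) r v) (sym (e≡ i))
        (proj₂ (∈-filter⁻ (dist≤? G r v) {xs = allFin (order G)} (∈-lookup i))))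
    , (λ w near → let w∈ = member w near in Any.index w∈ , trans (e≡ (Any.index w∈)) (sym (lookup-index w∈)))
    , (λ i j eq → lookup-injective (filter⁺ (dist≤? G r v) (allFin⁺ (order G))) i j
        (trans (sym (e≡ i)) (trans eq (e≡ j))))
    , (λ i j → sym (fromBits-toBits m matrix
        (λ i j → FinGraph.adj-sym G (lookup e i) (lookup e j))
        (λ i → FinGraph.adj-irrefl G (lookup e i)) i j))
    , trans (e≡ o) (sym (lookup-index v∈)) )
  where
  ws = filter (dist≤? G r v) (allFin (order G))
  m = length ws
  member : ∀ w → Dist≤ (graph G) r v w → w ∈ ws
  member w near = ∈-filter⁺ (dist≤? G r v) (∈-allFin w) near
  v∈ : v ∈ ws
  v∈ = member v (dist-refl (graph G))
  o : Fin m
  o = Any.index v∈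
  e : Vec (Fin (order G)) m
  e = tabulate (List.lookup ws)
  e≡ : ∀ i → lookup e i ≡ List.lookup ws i
  e≡ = lookup∘tabulate (List.lookup ws)
  matrix : Fin m → Fin m → Bool
  matrix i j = adj G (lookup e i) (lookup e j)
  bits = toBits m matrix
  F = fromBits m bits
  m≤M : m ≤ ballBound d r
  m≤M = ℕ.≤-trans (ℕ.≤-reflexive (length-filter-∑ (dist≤? G r v) (allFin (order G))))
    (ball-bound G deg r v)

-- Disjoint unions of rooted graphs

-- `sat?` covers graphs on `Fin n`; a disjoint union has a Σ-type of vertices, which is just as
-- searchable.
⊨-dec : (G : Graph) → DecidableEquality (V G) → (∀ u v → Dec (Graph._~_ G u v)) →
        ({P : Pred (V G) 0ℓ} → Decidable P → Dec (∀ v → P v)) →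
        ∀ {p} (φ : Formula p) ρ → Dec (G ⊨ φ [ ρ ])
⊨-dec G _≟_ _~?_ all? = go
  where
  go : ∀ {p} (φ : Formula p) ρ → Dec (G ⊨ φ [ ρ ])
  go (i ≐ j) ρ = ¬? (¬? (lookup ρ i ≟ lookup ρ j))
  go (i ∼ j) ρ = ¬? (¬? (lookup ρ i ~? lookup ρ j))
  go false   ρ = no id
  go (φ ⊃ ψ) ρ = go φ ρ →-dec go ψ ρ
  go (all φ) ρ = all? λ v → go φ (v ∷ ρ)

module Union {p} (X : Fin p → RootedGraph) where

  Vertex : Set
  Vertex = Σ (Fin p) λ i → Fin (order (proj₁ (X i)))

  -- As an inductive family, so that matching on an edge identifies the components of its endpoints.
  data Adjacent : Vertex → Vertex → Set where
    inside : ∀ {i a b} → T (adj (proj₁ (X i)) a b) → Adjacent (i , a) (i , b)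

  union : Graph
  union = record
    { V        = Vertex
    ; _~_      = Adjacent
    ; ~-sym    = λ { {i , a} {i , b} (inside t) → inside (Graph.~-sym (graph (proj₁ (X i))) t) }
    ; ~-irrefl = λ { {i , a} (inside t) → Graph.~-irrefl (graph (proj₁ (X i))) t }
    }

  roots : Vec Vertex p
  roots = tabulate λ i → i , proj₂ (X i)

  adjacent? : ∀ u v → Dec (Adjacent u v)
  adjacent? (i , a) (j , b) with i Fin.≟ j
  ... | no  i≢j  = no λ { (inside _) → i≢j refl }
  ... | yes refl = map′ inside (λ { (inside t) → t }) (T? (adj (proj₁ (X i)) a b))

  union-sat? : ∀ (φ : Formula p) → Dec (union ⊨ φ [ roots ])
  union-sat? φ = ⊨-dec union (Product.≡-dec Fin._≟_ Fin._≟_) adjacent?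
    (λ P? → map′ uncurry curry (Fin.all? λ i → Fin.all? λ a → P? (i , a))) φ roots

Separated : (G : Graph) → ℕ → ∀ {p} → Vec (V G) p → Set
Separated G R vs = ∀ i j → Dist≤ G R (lookup vs i) (lookup vs j) → i ≡ j

module _ (G : FinGraph) (r : ℕ) {p} (vs : Vec (Fin (order G)) p) (X : Fin p → RootedGraph)
         (balls : ∀ i → Ball≅ r G (lookup vs i) (X i))
         (separated : Separated (graph G) (r + suc r) vs) where

  open Union X

  private
    g = graph G
    W = N g r vs
    H = induced g W

    module I i = RootedIso (balls i)

    -- The centre of a vertex of `H` is hidden in an irrelevant proof and has to be found again by
    -- search.
    nearest : (x : V H) → W (value x)
    nearest (w , [ near ]) = recompute (Fin.any? λ i → dist≤? G r (lookup vs i) w) near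

    -- The origin of `r + suc r`: r steps from one centre to `x`, at most one edge to `y`, and r
    -- steps to the other centre. It excludes shared vertices as well as edges between balls.
    unique : ∀ {i j x y} → Dist≤ g r (lookup vs i) x → Dist≤ g r (lookup vs j) y → Dist≤ g 1 x y → i ≡ j
    unique {i} {j} dᵢ dⱼ xy = separated i j (dist-trans g dᵢ (dist-trans g xy (dist-sym g dⱼ)))

    unique-here : ∀ {i j x} → Dist≤ g r (lookup vs i) x → Dist≤ g r (lookup vs j) x → i ≡ j
    unique-here dᵢ dⱼ = unique dᵢ dⱼ (dist-refl g)

    place : ∀ {w} → W w → Vertex
    place {w} (i , d) = i , I.to i (w , [ d ])

    -- `place` reads the component off a membership proof. Separation makes the result independent
    -- of the proof, hence of which one `nearest` finds.
    place-unique : ∀ {w} (a b : W w) → place a ≡ place b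
    place-unique (i , d) (j , e) with unique-here d e
    ... | refl = refl

    unplace : Vertex → V H
    unplace (i , a) = value (I.from i a) , [ (i , near-centre (I.from i a)) ]
      where
      near-centre : (x : V (ball g r (lookup vs i))) → Dist≤ g r (lookup vs i) (value x)
      near-centre (w , [ near ]) = recompute (dist≤? G r (lookup vs i) w) near

    place-unplace : ∀ y → place (nearest (unplace y)) ≡ y
    place-unplace (i , a) = helper (I.from i a) refl (nearest (unplace (i , a)))
      where
      helper : (x : V (ball g r (lookup vs i))) → I.from i a ≡ x → (c : W (value x)) → place c ≡ (i , a)
      helper (w , [ near ]) eq c = trans
        (place-unique c (i , recompute (dist≤? G r (lookup vs i) w) near))
        (cong (i ,_) (trans (cong (I.to i) (sym eq)) (Inverse.strictlyInverseˡ (I.vertices i) a)))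

    unplace-place : ∀ {w} (c : W w) → value (unplace (place c)) ≡ w
    unplace-place (i , d) = cong value (Inverse.strictlyInverseʳ (I.vertices i) (_ , [ d ]))

    place-adjacent : ∀ {x y} (a : W x) (b : W y) → Graph._~_ g x y ⇔ Adjacent (place a) (place b)
    place-adjacent {x} {y} (i , d) (j , e) = mk⇔ forwards (backwards refl refl)
      where
      forwards : Graph._~_ g x y → Adjacent (place (i , d)) (place (j , e))
      forwards x~y with unique d e (dist-cons g x~y (dist-refl g))
      ... | refl = inside (I.adjacency i (x , [ d ]) (y , [ e ]) .to x~y)
      backwards : ∀ {u v} → u ≡ place (i , d) → v ≡ place (j , e) → Adjacent u v → Graph._~_ g x y
      backwards refl refl (inside t) = I.adjacency i (x , [ d ]) (y , [ e ]) .from t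

  separated-union : (φ : Formula p) → (H ⊨ φ [ centres g r vs ]) ⇔ (union ⊨ φ [ roots ])
  separated-union φ = ⊨-iso H union
    (mk↔ₛ′ (place ∘ nearest) unplace place-unplace (λ x → value-injective (unplace-place (nearest x))))
    (λ x y → place-adjacent (nearest x) (nearest y))
    φ (centres g r vs) roots root
    where
    at-centre : ∀ i (x : V H) → x ≡ (lookup vs i , [ (i , dist-refl g) ]) → place (nearest x) ≡ (i , proj₂ (X i))
    at-centre i x refl = trans (place-unique (nearest x) (i , dist-refl g)) (cong (i ,_) (I.root i))
    root : ∀ i → place (nearest (lookup (centres g r vs) i)) ≡ lookup roots i
    root i = trans (at-centre i _ (lookup∘tabulate _ i)) (sym (lookup∘tabulate _ i))

-- Tuples with two nearby entries are rare

Apart : (G : FinGraph) → ℕ → ∀ {p} → Vec (Fin (order G)) p → Fin (order G) → Set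
Apart G R vs v = ∀ i → ¬ Dist≤ (graph G) R (lookup vs i) v

apart? : ∀ G R {p} (vs : Vec (Fin (order G)) p) v → Dec (Apart G R vs v)
apart? G R vs v = Fin.all? λ i → ¬? (dist≤? G R (lookup vs i) v)

-- Recursive like `tuples`, unlike `Separated`, so that the exceptional tuples can be counted one
-- entry at a time.
data Far (G : FinGraph) (R : ℕ) : ∀ {p} → Vec (Fin (order G)) p → Set where
  []  : Far G R []
  _∷_ : ∀ {p v} {vs : Vec (Fin (order G)) p} → Apart G R vs v → Far G R vs → Far G R (v ∷ vs)

far? : ∀ G R {p} (vs : Vec (Fin (order G)) p) → Dec (Far G R vs)
far? G R []       = yes []
far? G R (v ∷ vs) with apart? G R vs v | far? G R vs
... | yes a | yes f = yes (a ∷ f)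
... | no ¬a | _     = no λ { (a ∷ _) → ¬a a }
... | _     | no ¬f = no λ { (_ ∷ f) → ¬f f }

far-separated : ∀ {G R p} {vs : Vec (Fin (order G)) p} → Far G R vs → Separated (graph G) R vs
far-separated (a ∷ f) zero    zero    _ = refl
far-separated {G} (a ∷ f) zero (suc j) d = contradiction (dist-sym (graph G) d) (a j)
far-separated (a ∷ f) (suc i) zero    d = contradiction d (a i)
far-separated (a ∷ f) (suc i) (suc j) d = cong suc (far-separated f i j d)

-- A union bound: either the tail already fails, or some entry of it is close to the new vertex.
¬far-split : ∀ G R {p} (vs : Vec (Fin (order G)) p) v →
  ⟦ ¬? (far? G R (v ∷ vs)) ⟧ ≤ ⟦ ¬? (far? G R vs) ⟧ + ∑ (allFin p) (λ i → ⟦ dist≤? G R (lookup vs i) v ⟧)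
¬far-split G R {p} vs v with apart? G R vs v | far? G R vs
... | yes a | yes f = z≤n
... | yes a | no ¬f = ℕ.m≤m+n 1 _
... | no ¬a | f     = ℕ.≤-trans close (ℕ.m≤n+m _ ⟦ ¬? f ⟧)
  where
  close : 1 ≤ ∑ (allFin p) (λ i → ⟦ dist≤? G R (lookup vs i) v ⟧)
  close with Fin.any? (λ i → dist≤? G R (lookup vs i) v)
  ... | yes (i , d) = subst (_≤ ∑ (allFin p) (λ i → ⟦ dist≤? G R (lookup vs i) v ⟧))
    (⟦⟧-true (dist≤? G R (lookup vs i) v) d)
    (∈⇒≤∑ (λ i → ⟦ dist≤? G R (lookup vs i) v ⟧) (∈-allFin i))
  ... | no ¬∃ = contradiction (λ i d → ¬∃ (i , d)) ¬a

nearCount : FinGraph → ℕ → ℕ → ℕ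
nearCount G R p = ∑ (tuples (order G) p) (λ vs → ⟦ ¬? (far? G R vs) ⟧)

-- In closed form, `M` times the number of pairs of positions among `p`.
nearBound : ℕ → ℕ → ℕ
nearBound M zero    = 0
nearBound M (suc p) = nearBound M p + p * M

-- The O(1 / |G|) estimate with denominators cleared. Each of the `p` entries of a tail spoils at
-- most `M` choices of the new vertex; exchanging the sums lets these choices be counted for a fixed
-- tail.
nearCount-bound : ∀ {d} G → MaxDegree≤ d G → ∀ R p →
  order G * nearCount G R p ≤ nearBound (ballBound d R) p * order G ^ p
nearCount-bound G deg R zero    = ℕ.≤-reflexive (ℕ.*-zeroʳ (order G))
nearCount-bound {d} G deg R (suc p) = begin
  n * nearCount G R (suc p)
    ≡⟨ cong (n *_) (∑-cartesianProductWith _∷_ (allFin n) (tuples n p) _) ⟩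
  n * ∑ (allFin n) (λ v → ∑ (tuples n p) (λ vs → ⟦ ¬? (far? G R (v ∷ vs)) ⟧))
    ≤⟨ ℕ.*-monoʳ-≤ n (∑-mono (allFin n) λ v → ∑-mono (tuples n p) λ vs → ¬far-split G R vs v) ⟩
  n * ∑ (allFin n) (λ v → ∑ (tuples n p) (λ vs → bad vs + close vs v))
    ≡⟨ cong (n *_) (∑-cong (allFin n) λ v → ∑-+ (tuples n p) bad (λ vs → close vs v)) ⟩
  n * ∑ (allFin n) (λ v → bads + ∑ (tuples n p) (λ vs → close vs v))
    ≡⟨ cong (n *_) (∑-+ (allFin n) (λ _ → bads) _) ⟩
  n * (∑ (allFin n) (λ _ → bads) + ∑ (allFin n) (λ v → ∑ (tuples n p) (λ vs → close vs v)))
    ≡⟨ cong (n *_) (cong₂ _+_ (trans (∑-const (allFin n) bads) (cong (_* bads) (length-allFin n)))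
         (∑-swap (allFin n) (tuples n p) (λ v vs → close vs v))) ⟩
  n * (n * bads + ∑ (tuples n p) (λ vs → ∑ (allFin n) (close vs)))
    ≤⟨ ℕ.*-monoʳ-≤ n (ℕ.+-mono-≤ (nearCount-bound G deg R p) (∑-mono (tuples n p) close-bound)) ⟩
  n * (nearBound M p * n ^ p + ∑ (tuples n p) (λ _ → p * M))
    ≡⟨ cong (λ t → n * (nearBound M p * n ^ p + t))
         (trans (∑-const (tuples n p) (p * M)) (cong (_* (p * M)) (length-tuples n p))) ⟩
  n * (nearBound M p * n ^ p + n ^ p * (p * M))
    ≡⟨ solve 4 (λ n c e m → n :* (c :* e :+ e :* m) := (c :+ m) :* (n :* e)) refl
         n (nearBound M p) (n ^ p) (p * M) ⟩
  nearBound M (suc p) * n ^ suc p ∎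
  where
  open ℕ.≤-Reasoning
  open ℕ-Solver using (solve; _:+_; _:*_; _:=_)
  n = order G
  M = ballBound d R
  bad : Vec (Fin n) p → ℕ
  bad vs = ⟦ ¬? (far? G R vs) ⟧
  bads = ∑ (tuples n p) bad
  close : Vec (Fin n) p → Fin n → ℕ
  close vs v = ∑ (allFin p) (λ i → ⟦ dist≤? G R (lookup vs i) v ⟧)
  close-bound : ∀ vs → ∑ (allFin n) (close vs) ≤ p * M
  close-bound vs = begin
    ∑ (allFin n) (close vs)
      ≡⟨ ∑-swap (allFin n) (allFin p) _ ⟩
    ∑ (allFin p) (λ i → ∑ (allFin n) (λ v → ⟦ dist≤? G R (lookup vs i) v ⟧))
      ≤⟨ ∑-mono (allFin p) (λ i → ball-bound G deg R (lookup vs i)) ⟩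
    ∑ (allFin p) (λ _ → M)
      ≡⟨ trans (∑-const (allFin p) M) (cong (_* M) (length-allFin p)) ⟩
    p * M ∎

-- Types of vertices

first : ∀ {n ℓ} {P : Pred (Fin n) ℓ} → Decidable P → ∃ P → ∃ λ i → P i × (∀ j → j Fin.< i → ¬ P j)
first {suc n} {P = P} P? (i , pᵢ) with P? zero
... | yes p₀ = zero , p₀ , λ _ ()
first {suc n} P? (zero  , p₀) | no ¬p₀ = contradiction p₀ ¬p₀
first {suc n} P? (suc i , pᵢ) | no ¬p₀ with first (P? ∘ suc) (i , pᵢ)
... | k , pₖ , min = suc k , pₖ , λ { zero _ → ¬p₀ ; (suc j) (s≤s j<k) → min j j<k }

module Types (d r : ℕ) (graphs : List RootedGraph)
             (complete : ∀ G → MaxDegree≤ d G → ∀ v → ∃ λ X → X ∈ graphs × Ball≅ r G v X) where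

  K : ℕ
  K = length graphs

  rep : Fin K → RootedGraph
  rep = List.lookup graphs

  -- A good representative j is its own ball, so this is isomorphism of i and
  -- j, in a form decided by ball≅?.
  repBall : Fin K → Fin K → Set
  repBall j i = Ball≅ r (proj₁ (rep j)) (proj₂ (rep j)) (rep i)

  -- The coefficients of the polynomial in the type frequencies: they are computed from the
  -- representatives and do not involve the graph whose tuples are counted.
  truth : ∀ {p} → Formula p → Vec (Fin K) p → ℕ
  truth φ js = ⟦ Union.union-sat? (rep ∘ lookup js) φ ⟧

  truth≤1 : ∀ {p} (φ : Formula p) js → truth φ js ≤ 1
  truth≤1 φ js = ⟦⟧≤1 (Union.union-sat? (rep ∘ lookup js) φ)

  module _ (G : FinGraph) (deg : MaxDegree≤ d G) where

    private
      hit : Fin (order G) → Fin K → Set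
      hit v i = Ball≅ r G v (rep i)

      -- Minimality singles out one index among isomorphic copies, so that each vertex is counted
      -- under exactly one type.
      classify : ∀ v → ∃ λ i → hit v i × (∀ j → j Fin.< i → ¬ hit v j)
      classify v = first (λ i → ball≅? r G v (rep i))
        (let (X , X∈ , iso) = complete G deg v
         in Any.index X∈ , subst (Ball≅ r G v) (lookup-index X∈) iso)

    type : Fin (order G) → Fin K
    type v = proj₁ (classify v)

    type-ball : ∀ v → Ball≅ r G v (rep (type v))
    type-ball v = proj₁ (proj₂ (classify v))

    type-first : ∀ v j → j Fin.< type v → ¬ Ball≅ r G v (rep j)
    type-first v = proj₂ (proj₂ (classify v))

    type-good : ∀ v → Good d r (rep (type v))
    type-good v = ball-good G deg v (rep (type v)) (type-ball v)

    same-class : ∀ {v i j} → Good d r (rep j) → hit v j → hit v i → repBall j i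
    same-class {j = j} good hⱼ hᵢ =
      rootedIso-trans (good-ball (rep j) good) (rootedIso-trans (rootedIso-sym hⱼ) hᵢ)

    transfer : ∀ {v i j} → Good d r (rep j) → hit v j → repBall j i → hit v i
    transfer {j = j} good hⱼ e =
      rootedIso-trans hⱼ (rootedIso-trans (rootedIso-sym (good-ball (rep j) good)) e)

    typeCount : Fin K → ℕ
    typeCount j = ∑ (allFin (order G)) (λ v → ⟦ type v Fin.≟ j ⟧)

    typeCount-zero : ∀ j → (∀ v → type v ≢ j) → typeCount j ≡ 0
    typeCount-zero j none = trans
      (∑-cong (allFin (order G)) {g = λ _ → 0} λ v → ⟦⟧-false (type v Fin.≟ j) (none v))
      (trans (∑-const (allFin (order G)) 0) (ℕ.*-zeroʳ (length (allFin (order G)))))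

    typeCount≤order : ∀ j → typeCount j ≤ order G
    typeCount≤order j = ℕ.≤-trans (∑-mono (allFin (order G)) λ v → ⟦⟧≤1 (type v Fin.≟ j))
      (ℕ.≤-reflexive (trans (sym (length-∑ (allFin (order G)))) (length-allFin (order G))))

    bad-type : ∀ j → ¬ Good d r (rep j) → typeCount j ≡ 0
    bad-type j ¬good = typeCount-zero j λ { v refl → ¬good (type-good v) }

    repeated-type : ∀ i j → i Fin.< j → Good d r (rep j) → repBall j i → typeCount j ≡ 0
    repeated-type i j i<j good e = typeCount-zero j λ { v refl →
      type-first v i i<j (transfer good (type-ball v) e) }

    -- Suppose the ball of a vertex is isomorphic to `rep j`. An earlier type would be an earlier
    -- isomorphic copy of `rep j`, and a later one would contradict minimality.
    new-type : ∀ j → Good d r (rep j) → (∀ i → i Fin.< j → ¬ repBall j i) →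
               ratio (typeCount j) (order G) ≡ ballFrequency r (proj₁ (rep j)) (proj₂ (rep j)) G
    new-type j good new = cong (λ k → ratio k (order G)) (trans
      (∑-cong (allFin (order G)) λ v → ⟦⟧-cong (type v Fin.≟ j) (ball≅? r G v (rep j))
        (mk⇔ (λ { refl → type-ball v }) (hit⇒type v)))
      (sym (length-filter-∑ (λ v → ball≅? r G v (rep j)) (allFin (order G)))))
      where
      hit⇒type : ∀ v → hit v j → type v ≡ j
      hit⇒type v hⱼ with Fin.<-cmp (type v) j
      ... | tri< t<j _ _ = contradiction (same-class good hⱼ (type-ball v)) (new (type v) t<j)
      ... | tri≈ _ t≡j _ = t≡j
      ... | tri> _ _ j<t = contradiction hⱼ (type-first v j j<t)

    typeSum : ∀ {p} → (Vec (Fin K) p → ℕ) → ℕ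
    typeSum {p} c = ∑ (tuples (order G) p) (λ vs → c (Vec.map type vs))

    -- Grouping by the type of the first entry. Iterated, this writes the sum as a polynomial in the
    -- numbers `typeCount j` with coefficients `c`.
    typeSum-suc : ∀ {p} (c : Vec (Fin K) (suc p) → ℕ) →
      typeSum c ≡ ∑ (allFin K) (λ j → typeCount j * typeSum (λ js → c (j ∷ js)))
    typeSum-suc {p} c = begin
      typeSum c
        ≡⟨ ∑-cartesianProductWith _∷_ (allFin (order G)) (tuples (order G) p) _ ⟩
      ∑ (allFin (order G)) (λ v → g (type v))
        ≡⟨ ∑-cong (allFin (order G)) (λ v → ∑-allFin-≡ (type v) g) ⟨
      ∑ (allFin (order G)) (λ v → ∑ (allFin K) (λ j → ⟦ type v Fin.≟ j ⟧ * g j))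
        ≡⟨ ∑-swap (allFin (order G)) (allFin K) _ ⟩
      ∑ (allFin K) (λ j → ∑ (allFin (order G)) (λ v → ⟦ type v Fin.≟ j ⟧ * g j))
        ≡⟨ ∑-cong (allFin K) (λ j → ∑-*ʳ (allFin (order G)) (g j) _) ⟩
      ∑ (allFin K) (λ j → typeCount j * g j) ∎
      where
      open ≡-Reasoning
      g : Fin K → ℕ
      g j = typeSum (λ js → c (j ∷ js))

    typeSum≤ : ∀ {p} (c : Vec (Fin K) p → ℕ) → (∀ js → c js ≤ 1) → typeSum c ≤ order G ^ p
    typeSum≤ {p} c c≤1 = ℕ.≤-trans (∑-mono (tuples (order G) p) λ vs → c≤1 (Vec.map type vs))
      (ℕ.≤-reflexive (trans (sym (length-∑ (tuples (order G) p))) (length-tuples (order G) p)))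

    module _ {p} (φ : Formula p) (local : IsLocal r φ) where

      far-truth : ∀ vs → Far G (r + suc r) vs → ⟦ sat? G φ vs ⟧ ≡ truth φ (Vec.map type vs)
      far-truth vs far = ⟦⟧-cong (sat? G φ vs) (Union.union-sat? X φ)
        (mk⇔ (equiv .to ∘ local (graph G) vs .to) (local (graph G) vs .from ∘ equiv .from))
        where
        X : Fin p → RootedGraph
        X = rep ∘ lookup (Vec.map type vs)
        equiv = separated-union G r vs X
          (λ i → subst (Ball≅ r G (lookup vs i) ∘ rep) (sym (lookup-map i type vs)) (type-ball (lookup vs i)))
          (far-separated far) φ

      -- The two counts agree on far tuples, and on each remaining tuple they differ by at most one.
      density-gap : gap ⟨ φ , G ⟩ (ratio (typeSum (truth φ)) (order G ^ p))
                    ℚ.≤ ratio (nearCount G (r + suc r) p) (order G ^ p)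
      density-gap = subst
        (λ k → gap (ratio k (order G ^ p)) (ratio (typeSum (truth φ)) (order G ^ p))
               ℚ.≤ ratio (nearCount G (r + suc r) p) (order G ^ p))
        (sym (length-filter-∑ (sat? G φ) (tuples (order G) p)))
        (ratio-gap {satSum} {typeSum (truth φ)} {nearCount G (r + suc r) p} (order G ^ p)
          (bound (λ vs → ⟦ sat? G φ vs ⟧) (truth φ ∘ Vec.map type) (λ vs → ⟦⟧≤1 (sat? G φ vs))
            (λ vs far → ℕ.≤-reflexive (far-truth vs far)))
          (bound (truth φ ∘ Vec.map type) (λ vs → ⟦ sat? G φ vs ⟧)
            (truth≤1 φ ∘ Vec.map type)
            (λ vs far → ℕ.≤-reflexive (sym (far-truth vs far)))))
        where
        satSum = ∑ (tuples (order G) p) (λ vs → ⟦ sat? G φ vs ⟧)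
        bound : (f g : Vec (Fin (order G)) p → ℕ) → (∀ vs → f vs ≤ 1) →
                (∀ vs → Far G (r + suc r) vs → f vs ≤ g vs) →
                ∑ (tuples (order G) p) f ≤ ∑ (tuples (order G) p) g + nearCount G (r + suc r) p
        bound f g f≤1 f≤g = ℕ.≤-trans (∑-mono (tuples (order G) p) pointwise)
          (ℕ.≤-reflexive (∑-+ (tuples (order G) p) g (λ vs → ⟦ ¬? (far? G (r + suc r) vs) ⟧)))
          where
          pointwise : ∀ vs → f vs ≤ g vs + ⟦ ¬? (far? G (r + suc r) vs) ⟧
          pointwise vs with far? G (r + suc r) vs
          ... | yes far = ℕ.≤-trans (f≤g vs far) (ℕ.m≤m+n (g vs) 0)
          ... | no  _   = ℕ.≤-trans (f≤1 vs) (ℕ.m≤n+m 1 (g vs))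

-- Convergence of type frequencies and of densities

module _ (d : ℕ) (G : ℕ → FinGraph) (deg : ∀ n → MaxDegree≤ d (G n)) (bs : BSConvergent d G) where

  module _ (r : ℕ) (graphs : List RootedGraph)
           (complete : ∀ G → MaxDegree≤ d G → ∀ v → ∃ λ X → X ∈ graphs × Ball≅ r G v X) where

    open Types d r graphs complete

    typeFrequency : Fin K → ℕ → ℚ
    typeFrequency j n = ratio (typeCount (G n) (deg n) j) (order (G n))

    Cauchy-absent : ∀ j → (∀ n → typeCount (G n) (deg n) j ≡ 0) → Cauchy (typeFrequency j)
    Cauchy-absent j absent = Cauchy-cong {λ _ → 0ℚ} {typeFrequency j}
      (λ n → sym (trans (cong (λ k → ratio k (order (G n))) (absent n)) (ratio-0 (order (G n)))))
      (Cauchy-const 0ℚ)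

    Cauchy-new : ∀ j → Good d r (rep j) → (∀ i → i Fin.< j → ¬ repBall j i) → Cauchy (typeFrequency j)
    Cauchy-new j good new = Cauchy-cong {frequency} {typeFrequency j}
      (λ n → sym (new-type (G n) (deg n) j good new))
      (Converges⇒Cauchy {frequency}
        (bs r (proj₁ (rep j)) (proj₂ (rep j)) (good-connected (rep j) good) (proj₁ good)))
      where
      frequency : ℕ → ℚ
      frequency n = ballFrequency r (proj₁ (rep j)) (proj₂ (rep j)) (G n)

    -- The cases concern the list of representatives alone, so the same case applies to every `G n`.
    Cauchy-typeCount : ∀ j → Cauchy (typeFrequency j)
    Cauchy-typeCount j = cases (good? d r (rep j))
      (Fin.any? λ i → i Fin.<? j ×-dec ball≅? r (proj₁ (rep j)) (proj₂ (rep j)) (rep i))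
      where
      cases : Dec (Good d r (rep j)) → Dec (∃ λ i → i Fin.< j × repBall j i) → Cauchy (typeFrequency j)
      cases (no ¬good) _ = Cauchy-absent j λ n → bad-type (G n) (deg n) j ¬good
      cases (yes good) (yes (i , i<j , e)) = Cauchy-absent j λ n → repeated-type (G n) (deg n) i j i<j good e
      cases (yes good) (no ¬∃) = Cauchy-new j good λ i i<j e → ¬∃ (i , i<j , e)

    -- Induction on `p`, splitting off one factor by `typeSum-suc`. The bound on `c` keeps the
    -- remaining factor at most 1, as the product rule `Cauchy-*` requires.
    Cauchy-typeSum : ∀ {p} (c : Vec (Fin K) p → ℕ) → (∀ js → c js ≤ 1) →
                     Cauchy (λ n → ratio (typeSum (G n) (deg n) c) (order (G n) ^ p))
    Cauchy-typeSum {zero}  c c≤1 = Cauchy-const (ratio (c [] + 0) 1)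
    Cauchy-typeSum {suc p} c c≤1 =
      Cauchy-cong {λ n → ratio (∑ (allFin K) (λ j → count j n * rest j n)) (order (G n) ^ suc p)}
        {λ n → ratio (typeSum (G n) (deg n) c) (order (G n) ^ suc p)}
        (λ n → cong (λ k → ratio k (order (G n) ^ suc p)) (sym (typeSum-suc (G n) (deg n) c)))
        (Cauchy-∑ (allFin K) (λ j n → count j n * rest j n) (λ n → order (G n) ^ suc p) λ j →
          Cauchy-cong {λ n → ratio (count j n) (order (G n)) ℚ.* ratio (rest j n) (order (G n) ^ p)}
            {λ n → ratio (count j n * rest j n) (order (G n) ^ suc p)}
            (λ n → sym (ratio-* (count j n) (rest j n) (order (G n)) (order (G n) ^ p)))
            (Cauchy-* {λ n → ratio (count j n) (order (G n))} {λ n → ratio (rest j n) (order (G n) ^ p)}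
              (λ n → ratio-unitBounded (typeCount≤order (G n) (deg n) j))
              (λ n → ratio-unitBounded (typeSum≤ (G n) (deg n) (λ js → c (j ∷ js)) (λ js → c≤1 (j ∷ js))))
              (Cauchy-typeCount j) (Cauchy-typeSum (λ js → c (j ∷ js)) (λ js → c≤1 (j ∷ js)))))
      where
      count rest : Fin K → ℕ → ℕ
      count j n = typeCount (G n) (deg n) j
      rest j n = typeSum (G n) (deg n) (λ js → c (j ∷ js))

    Cauchy-density : OrderTendsToInfinity G → ∀ {p} (φ : Formula p) → IsLocal r φ → Cauchy (λ n → ⟨ φ , G n ⟩)
    Cauchy-density large {p} φ local =
      Cauchy-near {λ n → ⟨ φ , G n ⟩} {λ n → ratio (typeSum (G n) (deg n) (truth φ)) (order (G n) ^ p)}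
        close (Cauchy-typeSum (truth φ) (truth≤1 φ))
      where
      bound = nearBound (ballBound d (r + suc r)) p
      close : ∀ ε → 0ℚ ℚ.< ε → ∃ λ M → ∀ n → M ≤ n →
              gap ⟨ φ , G n ⟩ (ratio (typeSum (G n) (deg n) (truth φ)) (order (G n) ^ p)) ℚ.≤ ε
      close ε 0<ε =
        let (M , vanish) = ratio-vanishes bound ε 0<ε
            -- `suc M` instead of `M` also makes the order positive, which `ratio-≤′` needs.
            (L , order≥) = large (suc M)
        in L , λ n L≤n → begin
          gap ⟨ φ , G n ⟩ (ratio (typeSum (G n) (deg n) (truth φ)) (order (G n) ^ p))
            ≤⟨ density-gap (G n) (deg n) φ local ⟩
          ratio (nearCount (G n) (r + suc r) p) (order (G n) ^ p)
            ≤⟨ ratio-≤′ (ℕ.≤-trans (s≤s z≤n) (order≥ n L≤n)) (nearCount-bound (G n) (deg n) (r + suc r) p) ⟩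
          ratio bound (order (G n))
            ≤⟨ vanish (order (G n)) (ℕ.≤-trans (ℕ.n≤1+n M) (order≥ n L≤n)) ⟩
          ε ∎
        where open ℚ.≤-Reasoning

  BS⇒FO-local : OrderTendsToInfinity G → Convergent FO-local G
  BS⇒FO-local large φ (r , local) = Cauchy⇒Converges {λ n → ⟨ φ , G n ⟩}
    (Cauchy-density r (rootedGraphs (ballBound d r)) (ball∈rootedGraphs r) large φ local)

theorem4p5 : (d : ℕ) (G : ℕ → FinGraph) →
    (∀ n → MaxDegree≤ d (G n)) →
    OrderTendsToInfinity G →
    (BSConvergent d G ⇔ Convergent FO-local₁ G)
    × (Convergent FO-local₁ G ⇔ Convergent FO-local G)
theorem4p5 d G deg large =
  mk⇔ {A = BSConvergent d G} {B = Convergent FO-local₁ G}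
    (λ bs → FO-local⇒FO-local₁ G (BS⇒FO-local d G deg bs large))
    (FO-local₁⇒BS d G) ,
  mk⇔ {A = Convergent FO-local₁ G} {B = Convergent FO-local G}
    (λ conv → BS⇒FO-local d G deg (FO-local₁⇒BS d G conv) large)
    (FO-local⇒FO-local₁ G)
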